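{- Let $P_{(3,0)}$ be the set of all cylindric partitions with profile $c=(3,0)$. Then, as formal power series in $q$, $$\sum_{\Lambda\in P_{(3,0)}} q^{|\Lambda|}=\left(\sum_{n\ge0}\frac{q^{n^2+2n}}{(q^4;q^4)_n}\right)\frac{(-q^2;q^2)_\infty}{(q;q)_\infty}.$$
   Context: Let $r,\ell$ be positive integers and $c=(c_1,\dots,c_r)$ a composition of $\ell$ into $r$ nonnegative integer parts (zero entries allowed). A cylindric partition with profile $c$ is a tuple $\Lambda=(\lambda^{(1)},\dots,\lambda^{(r)})$ of ordinary partitions $\lambda^{(i)}=(\lambda^{(i)}_1\ge\lambda^{(i)}_2\ge\cdots)$ (parts beyond the length are taken to be $0$) such that for all $i,j$: $\lambda^{(i)}_j\ge\lambda^{(i+1)}_{j+c_{i+1}}$ for $1\le i\le r-1$, and $\lambda^{(r)}_j\ge\lambda^{(1)}_{j+c_1}$. The size $|\Lambda|$ is the sum of all parts of all $\lambda^{(i)}$; the empty cylindric partition is included with size $0$. Notation: $(a;q)_n=\prod_{k=1}^n(1-aq^{k-1})$, $(a;q)_\infty=\lim_{n\to\infty}(a;q)_n$. -}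

module Defs where

open import Data.Nat as ℕ using (ℕ; zero; suc; _∸_; _≤_; _<_; _<?_; _≟_; s≤s)
open import Data.Integer as ℤ using (ℤ; 0ℤ; 1ℤ)
open import Data.Fin as Fin using (Fin; toℕ; fromℕ<)
open import Data.List as List using (List; []; _∷_; applyUpTo; foldr; length)
open import Data.List.Relation.Unary.All using (All)
open import Data.List.Relation.Unary.Linked using (Linked)
open import Data.Vec as Vec using (Vec; _∷_; []; lookup)
open import Data.Nat.ListAction as ListAction using ()
open import Data.Bool using (if_then_else_)
open import Data.Product using (_×_)
open import Relation.Nullary using (does; yes; no)

IsPartition : List ℕ → Set
IsPartition l = Linked (λ x y → y ≤ x) l × All (λ x → 0 < x) l

-- j-th part, 0-indexed (part λ 0 = λ_1); parts beyond the length are 0.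
part : List ℕ → ℕ → ℕ
part []       _       = 0
part (x ∷ _)  zero    = x
part (_ ∷ xs) (suc j) = part xs j

next : ∀ {n} → Fin n → Fin n
next {suc n} i with suc (toℕ i) <? suc n
... | yes p = fromℕ< p
... | no  _ = Fin.zero

CylPart : ∀ {r} → Vec ℕ r → Vec (List ℕ) r → Set
CylPart {r} c Λ =
  ((i : Fin r) → IsPartition (lookup Λ i)) ×
  ((i : Fin r) (j : ℕ) →
     part (lookup Λ (next i)) (j ℕ.+ lookup c (next i)) ≤ part (lookup Λ i) j)

size : ∀ {r} → Vec (List ℕ) r → ℕ
size []       = 0
size (l ∷ Λ)  = ListAction.sum l ℕ.+ size Λ

profile30 : Vec ℕ 2
profile30 = 3 ∷ 0 ∷ []

FPS : Set
FPS = ℕ → ℤ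

sumℤ : List ℤ → ℤ
sumℤ = foldr ℤ._+_ 0ℤ

one : FPS
one zero    = 1ℤ
one (suc _) = 0ℤ

qpow : ℕ → FPS
qpow m n = if does (m ≟ n) then 1ℤ else 0ℤ

_⊕_ : FPS → FPS → FPS
(f ⊕ g) n = f n ℤ.+ g n

neg : FPS → FPS
neg f n = ℤ.- f n

_⊖_ : FPS → FPS → FPS
f ⊖ g = f ⊕ neg g

_⊛_ : FPS → FPS → FPS
(f ⊛ g) n = sumℤ (applyUpTo (λ k → f k ℤ.* g (n ∸ k)) (suc n))

infixl 7 _⊛_
infixl 6 _⊕_ _⊖_

powS : FPS → ℕ → FPS
powS b zero    = one
powS b (suc k) = powS b k ⊛ b

poch : FPS → FPS → ℕ → FPS
poch a b zero    = one
poch a b (suc n) = poch a b n ⊛ (one ⊖ a ⊛ powS b n)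

-- (a;b)_∞ for a, b without constant term: coefficient of q^N is that of
-- the finite product (a;b)_{N+1}, as the remaining factors are 1 + O(q^{N+1}).
pochInf : FPS → FPS → FPS
pochInf a b N = poch a b (suc N) N

-- multiplicative inverse of a series with constant term 1:
-- b_0 = 1,  b_n = - Σ_{k=1}^{n} f_k b_{n-k}.
-- invVec f n = (b_n, b_{n-1}, …, b_0)
invVec : FPS → (n : ℕ) → Vec ℤ (suc n)
invVec f zero    = 1ℤ ∷ []
invVec f (suc n) =
  let bs = invVec f n in
  ℤ.- sumℤ (Vec.toList (Vec.zipWith ℤ._*_ (Vec.tabulate (λ k → f (suc (toℕ k)))) bs))
  ∷ bs

inv : FPS → FPS
inv f n = Vec.head (invVec f n)

-- Σ_{n ≥ 0} F n, for a family with F n = O(q^n): the coefficient of q^N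
-- only receives contributions from n ≤ N.
sumSeries : (ℕ → FPS) → FPS
sumSeries F N = sumℤ (applyUpTo (λ n → F n N) (suc N))

rhs : FPS
rhs = sumSeries (λ n → qpow (n ℕ.* n ℕ.+ 2 ℕ.* n) ⊛ inv (poch (qpow 4) (qpow 4) n))
      ⊛ pochInf (neg (qpow 2)) (qpow 2)
      ⊛ inv (pochInf (qpow 1) (qpow 1))

{-# OPTIONS --safe #-}
-- Conjugating both partitions turns a cylindric partition into a weakly decreasing chain of pairs
-- (a , b) of column heights with b ≤ a ≤ b + 3.  Each weight s = a + b occurs with at most two
-- pairs, a middle one (a − b = 1 or 2) and an extreme one (a − b = 0 or 3).  Two pairs of different
-- weights are comparable unless both are extreme and their weights are adjacent.  If y_s and z_s count
-- the chains below the middle and below the extreme pair of weight s, this gives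
--     (1 − q^(s+1)) y_(s+1) = y_s + q^s z_s,    (1 − q^(s+1)) z_(s+1) = y_s,
-- so (q;q)_s y_s satisfies the Rogers–Ramanujan recurrence.  On the series side,
--     U_i = Σ_n q^(n² + 2n + 2in) / ((q²;q²)_n (−q²;q²)_(n+i)),
--     V_i = Σ_n q^(n² + 2in) / ((q²;q²)_n (−q²;q²)_(n+i))
-- satisfy U_i = V_(i+1) + q^(2i+2) U_(i+1) and V_i = U_i + q^(2i+1) V_(i+1), so that
-- U_0, V_1, U_1, V_2, … solves the same recurrence read from the other end.  Hence
--     U_0 = (q;q)_s (y_s U_i + q^s z_s V_(i+1))    for s = 2i + 1,
-- and modulo q^(i+1) the right side is (q;q)_∞ y_s / (−q²;q²)_∞, where y_s has already reached its limit.
module Submission where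

open import Defs
open import Data.Nat as ℕ using (ℕ; zero; suc; pred; _∸_; _≤_; _<_; z≤n; s≤s; z<s; s≤s⁻¹)
import Data.Nat.Properties as ℕ
import Data.Nat.Tactic.RingSolver as ℕ
open import Data.Nat.Induction using (<-rec)
open import Data.Nat.ListAction using (sum)
open import Data.Integer as ℤ using (ℤ; +_; 0ℤ; 1ℤ)
import Data.Integer.Properties as ℤ
import Data.Integer.Tactic.RingSolver as ℤ
open import Data.Fin using (toℕ) renaming (zero to fzero; suc to fsuc)
open import Data.List using (List; []; _∷_; applyUpTo; length; map; _++_)
open import Data.List.Properties using (length-map; length-++)
open import Data.List.Membership.Propositional using (_∈_)
open import Data.List.Membership.Propositional.Properties using (∈-++⁺ˡ; ∈-++⁺ʳ; ∈-map⁺)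
open import Data.List.Relation.Unary.All as All using (All; []; _∷_)
import Data.List.Relation.Unary.All.Properties as All
open import Data.List.Relation.Unary.AllPairs using ([]; _∷_)
open import Data.List.Relation.Unary.Any using (here)
open import Data.List.Relation.Unary.Linked using (Linked; []; [-]; _∷_)
open import Data.List.Relation.Unary.Unique.Propositional using (Unique)
open import Data.List.Relation.Unary.Unique.Propositional.Properties using (++⁺)
open import Data.Vec as Vec using (Vec; []; _∷_)
open import Data.Product using (Σ; _×_; _,_; proj₂)
open import Data.Sum using (_⊎_; inj₁; inj₂)
open import Data.Empty using (⊥-elim)
open import Function using (_∘_)
open import Level using (0ℓ)
open import Relation.Nullary using (¬_; yes; no)
open import Relation.Binary.PropositionalEquality
  using (_≡_; _≢_; refl; sym; trans; cong; cong₂; subst; subst₂)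
open import Algebra.Bundles using (CommutativeRing)

-- The ring of formal power series

infix 4 _≈_
-- A record, because the bare type `∀ n → f n ≡ g n` would not let unification recover `f` and `g`.
record _≈_ (f g : FPS) : Set where
  constructor coeffwise
  field at : ∀ n → f n ≡ g n
open _≈_

≈-refl : ∀ {f} → f ≈ f
≈-refl .at n = refl

≈-sym : ∀ {f g} → f ≈ g → g ≈ f
≈-sym p .at n = sym (p .at n)

≈-trans : ∀ {f g h} → f ≈ g → g ≈ h → f ≈ h
≈-trans p q .at n = trans (p .at n) (q .at n)

0S : FPS
0S _ = 0ℤ

-- `(f ⊛ g) (suc n)` unfolds to `f 0 ℤ.* g (suc n) ℤ.+ (tail f ⊛ g) n`, so the ring laws go by
-- induction on `n` with `f` replaced by `tail f`.
tail : FPS → FPS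
tail f n = f (suc n)

⊛-cong-upto : ∀ f f′ g g′ n → (∀ k → k ≤ n → f k ≡ f′ k) → (∀ k → k ≤ n → g k ≡ g′ k) →
  (f ⊛ g) n ≡ (f′ ⊛ g′) n
⊛-cong-upto f f′ g g′ zero p q =
  cong (ℤ._+ 0ℤ) (cong₂ ℤ._*_ (p 0 z≤n) (q 0 z≤n))
⊛-cong-upto f f′ g g′ (suc n) p q =
  cong₂ ℤ._+_ (cong₂ ℤ._*_ (p 0 z≤n) (q (suc n) ℕ.≤-refl))
    (⊛-cong-upto (tail f) (tail f′) g g′ n (λ k l → p (suc k) (s≤s l))
      (λ k l → q k (ℕ.m≤n⇒m≤1+n l)))

⊛-cong : ∀ {f f′ g g′} → f ≈ f′ → g ≈ g′ → f ⊛ g ≈ f′ ⊛ g′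
⊛-cong {f} {f′} {g} {g′} p q .at n =
  ⊛-cong-upto f f′ g g′ n (λ k _ → p .at k) (λ k _ → q .at k)

⊛-distribʳ : ∀ h f g → (f ⊕ g) ⊛ h ≈ f ⊛ h ⊕ g ⊛ h
⊛-distribʳ h f g .at = go f g
  where
  base : ∀ x y c → (x ℤ.+ y) ℤ.* c ℤ.+ 0ℤ ≡ (x ℤ.* c ℤ.+ 0ℤ) ℤ.+ (y ℤ.* c ℤ.+ 0ℤ)
  base = ℤ.solve-∀
  step : ∀ x y c s t → (x ℤ.+ y) ℤ.* c ℤ.+ (s ℤ.+ t) ≡ (x ℤ.* c ℤ.+ s) ℤ.+ (y ℤ.* c ℤ.+ t)
  step = ℤ.solve-∀
  go : ∀ f g n → ((f ⊕ g) ⊛ h) n ≡ (f ⊛ h ⊕ g ⊛ h) n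
  go f g zero    = base (f 0) (g 0) (h 0)
  go f g (suc n) = trans (cong (ℤ._+_ ((f 0 ℤ.+ g 0) ℤ.* h (suc n))) (go (tail f) (tail g) n))
    (step (f 0) (g 0) (h (suc n)) _ _)

-- Splits off the last term of the convolution where the definition splits off the first; matching
-- the two gives commutativity.
⊛-suc : ∀ f g n → (f ⊛ g) (suc n) ≡ g 0 ℤ.* f (suc n) ℤ.+ (f ⊛ tail g) n
⊛-suc f g zero    = lem (f 0) (f 1) (g 0) (g 1)
  where
  lem : ∀ a b c d → a ℤ.* d ℤ.+ (b ℤ.* c ℤ.+ 0ℤ) ≡ c ℤ.* b ℤ.+ (a ℤ.* d ℤ.+ 0ℤ)
  lem = ℤ.solve-∀
⊛-suc f g (suc n) =
  trans (cong (ℤ._+_ (f 0 ℤ.* g (suc (suc n)))) (⊛-suc (tail f) g n)) (lem (f 0 ℤ.* g (suc (suc n))) (g 0 ℤ.* f (suc (suc n))) _)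
  where
  lem : ∀ a b c → a ℤ.+ (b ℤ.+ c) ≡ b ℤ.+ (a ℤ.+ c)
  lem = ℤ.solve-∀

⊛-comm : ∀ f g → f ⊛ g ≈ g ⊛ f
⊛-comm f g .at = go f
  where
  go : ∀ f n → (f ⊛ g) n ≡ (g ⊛ f) n
  go f zero    = cong (ℤ._+ 0ℤ) (ℤ.*-comm (f 0) (g 0))
  go f (suc n) = trans (cong (ℤ._+_ (f 0 ℤ.* g (suc n))) (go (tail f) n)) (sym (⊛-suc g f n))

⊛-scale : ∀ c f g n → ((λ k → c ℤ.* f k) ⊛ g) n ≡ c ℤ.* (f ⊛ g) n
⊛-scale c f g zero    = lem c (f 0) (g 0)
  where
  lem : ∀ a b c → (a ℤ.* b) ℤ.* c ℤ.+ 0ℤ ≡ a ℤ.* (b ℤ.* c ℤ.+ 0ℤ)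
  lem = ℤ.solve-∀
⊛-scale c f g (suc n) =
  trans (cong (ℤ._+_ (c ℤ.* f 0 ℤ.* g (suc n))) (⊛-scale c (tail f) g n)) (lem c (f 0) (g (suc n)) _)
  where
  lem : ∀ a b c d → (a ℤ.* b) ℤ.* c ℤ.+ a ℤ.* d ≡ a ℤ.* (b ℤ.* c ℤ.+ d)
  lem = ℤ.solve-∀

⊛-assoc : ∀ f g h → (f ⊛ g) ⊛ h ≈ f ⊛ (g ⊛ h)
⊛-assoc f g h .at = go f
  where
  base : ∀ a b c → (a ℤ.* b ℤ.+ 0ℤ) ℤ.* c ℤ.+ 0ℤ ≡ a ℤ.* (b ℤ.* c ℤ.+ 0ℤ) ℤ.+ 0ℤ
  base = ℤ.solve-∀
  step : ∀ a b c d e → (a ℤ.* b ℤ.+ 0ℤ) ℤ.* c ℤ.+ (a ℤ.* d ℤ.+ e) ≡ a ℤ.* (b ℤ.* c ℤ.+ d) ℤ.+ e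
  step = ℤ.solve-∀
  go : ∀ f n → ((f ⊛ g) ⊛ h) n ≡ (f ⊛ (g ⊛ h)) n
  go f zero    = base (f 0) (g 0) (h 0)
  go f (suc n) = trans
    (cong (ℤ._+_ ((f ⊛ g) 0 ℤ.* h (suc n)))
      -- By definition `tail (f ⊛ g)` is `f 0` times `tail g`, plus `tail f ⊛ g`.
      (trans (⊛-distribʳ h (λ k → f 0 ℤ.* tail g k) (tail f ⊛ g) .at n)
        (cong₂ ℤ._+_ (⊛-scale (f 0) (tail g) h n) (go (tail f) n))))
    (step (f 0) (g 0) (h (suc n)) _ _)

⊛-zeroˡ : ∀ g → 0S ⊛ g ≈ 0S
⊛-zeroˡ g .at zero    = cong (ℤ._+ 0ℤ) (ℤ.*-zeroˡ (g 0))
⊛-zeroˡ g .at (suc n) = cong₂ ℤ._+_ (ℤ.*-zeroˡ (g (suc n))) (⊛-zeroˡ g .at n)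

⊛-identityˡ : ∀ g → one ⊛ g ≈ g
⊛-identityˡ g .at zero    = trans (ℤ.+-identityʳ _) (ℤ.*-identityˡ (g 0))
⊛-identityˡ g .at (suc n) =
  trans (cong₂ ℤ._+_ (ℤ.*-identityˡ (g (suc n))) (⊛-zeroˡ g .at n)) (ℤ.+-identityʳ _)

FPS-ring : CommutativeRing 0ℓ 0ℓ
FPS-ring = record
  { Carrier = FPS ; _≈_ = _≈_ ; _+_ = _⊕_ ; _*_ = _⊛_ ; -_ = neg ; 0# = 0S ; 1# = one
  ; isCommutativeRing = record
    { isRing = record
      { +-isAbelianGroup = record
        { isGroup = record
          { isMonoid = record
            { isSemigroup = record
              { isMagma = record
                { isEquivalence = record { refl = ≈-refl ; sym = ≈-sym ; trans = ≈-trans }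
                ; ∙-cong = λ p q → coeffwise λ n → cong₂ ℤ._+_ (p .at n) (q .at n) }
              ; assoc = λ f g h → coeffwise λ n → ℤ.+-assoc (f n) (g n) (h n) }
            ; identity = (λ f → coeffwise λ n → ℤ.+-identityˡ (f n))
                       , (λ f → coeffwise λ n → ℤ.+-identityʳ (f n)) }
          ; inverse = (λ f → coeffwise λ n → ℤ.+-inverseˡ (f n))
                    , (λ f → coeffwise λ n → ℤ.+-inverseʳ (f n))
          ; ⁻¹-cong = λ p → coeffwise λ n → cong ℤ.-_ (p .at n) }
        ; comm = λ f g → coeffwise λ n → ℤ.+-comm (f n) (g n) }
      ; *-cong = ⊛-cong
      ; *-assoc = ⊛-assoc
      ; *-identity = ⊛-identityˡ , λ f → ≈-trans (⊛-comm f one) (⊛-identityˡ f)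
      ; distrib = (λ h f g → ≈-trans (⊛-comm h (f ⊕ g))
                    (≈-trans (⊛-distribʳ h f g)
                      (coeffwise λ n → cong₂ ℤ._+_ (⊛-comm f h .at n) (⊛-comm g h .at n))))
                , ⊛-distribʳ }
    ; *-comm = ⊛-comm } }

open CommutativeRing FPS-ring
  using (+-cong; +-congˡ; +-congʳ; *-congˡ; *-congʳ; -‿cong; setoid; ring; commutativeSemiring)
  renaming ( +-comm to ⊕-comm; +-assoc to ⊕-assoc; +-identityʳ to ⊕-identityʳ; -‿inverseˡ to ⊕-inverseˡ
           ; *-identityʳ to ⊛-identityʳ; zeroʳ to ⊛-zeroʳ; reflexive to ≈-reflexive)
open import Algebra.Properties.Ring ring using (-‿distribˡ-*; -‿distribʳ-*)
open import Algebra.Solver.Ring.NaturalCoefficients.Default commutativeSemiring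
  using (solve; _:=_; _:+_; _:*_; con)
open import Relation.Binary.Reasoning.Setoid setoid

-- Powers of q and reciprocals

qpow-zero : qpow 0 ≈ one
qpow-zero .at zero    = refl
qpow-zero .at (suc n) = refl

qpow-⊛-+ : ∀ m f n → (qpow m ⊛ f) (m ℕ.+ n) ≡ f n
qpow-⊛-+ zero f n = trans (⊛-cong {g = f} qpow-zero ≈-refl .at n) (⊛-identityˡ f .at n)
qpow-⊛-+ (suc m) f n = trans (cong₂ ℤ._+_ (ℤ.*-zeroˡ (f (suc (m ℕ.+ n)))) (qpow-⊛-+ m f n)) (ℤ.+-identityˡ _)

qpow-⊛-< : ∀ m f n → n < m → (qpow m ⊛ f) n ≡ 0ℤ
qpow-⊛-< (suc m) f zero _ = cong (ℤ._+ 0ℤ) (ℤ.*-zeroˡ (f 0))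
qpow-⊛-< (suc m) f (suc n) (s≤s p) = cong₂ ℤ._+_ (ℤ.*-zeroˡ (f (suc n))) (qpow-⊛-< m f n p)

qpow-⊛-qpow : ∀ m n → qpow m ⊛ qpow n ≈ qpow (m ℕ.+ n)
qpow-⊛-qpow m n .at = go m
  where
  go : ∀ m k → (qpow m ⊛ qpow n) k ≡ qpow (m ℕ.+ n) k
  go zero k = trans (⊛-cong {g = qpow n} qpow-zero ≈-refl .at k) (⊛-identityˡ (qpow n) .at k)
  go (suc m) zero = refl
  go (suc m) (suc k) = trans (cong₂ ℤ._+_ (ℤ.*-zeroˡ (qpow n (suc k))) (go m k)) (ℤ.+-identityˡ _)

⊖-⊕ : ∀ f g → (f ⊖ g) ⊕ g ≈ f
⊖-⊕ f g .at n = lem (f n) (g n)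
  where
  lem : ∀ a b → (a ℤ.- b) ℤ.+ b ≡ a
  lem = ℤ.solve-∀

⊛-inv : ∀ f → f 0 ≡ 1ℤ → f ⊛ inv f ≈ one
⊛-inv f f0 .at zero    = cong (λ x → x ℤ.* 1ℤ ℤ.+ 0ℤ) f0
⊛-inv f f0 .at (suc n) = trans
  (cong₂ ℤ._+_ (cong₂ (λ x y → x ℤ.* (ℤ.- y)) f0 (dot n (tail f))) refl)
  (trans (cong (ℤ._+ (tail f ⊛ inv f) n) (ℤ.*-identityˡ (ℤ.- (tail f ⊛ inv f) n)))
    (ℤ.+-inverseˡ ((tail f ⊛ inv f) n)))
  where
  -- `invVec f n` lists the coefficients of `inv f` from `n` down to 0, so its dot products are
  -- convolution coefficients. The series `g` is arbitrary so that the induction can pass to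
  -- `tail g`.
  dot : ∀ n g → sumℤ (Vec.toList (Vec.zipWith ℤ._*_ (Vec.tabulate (λ k → g (toℕ k))) (invVec f n)))
    ≡ (g ⊛ inv f) n
  dot zero    g = refl
  dot (suc n) g = cong (ℤ._+_ (g 0 ℤ.* inv f (suc n))) (dot n (tail g))

-- Cylindric partitions as chains of columns

-- The conclusion of the theorem for an abstract predicate; the number is an integer so that it
-- compares directly with a coefficient.
Count : {A : Set} → (A → Set) → ℤ → Set
Count {A} P c = Σ (List A) λ L →
  All P L × Unique L × ((x : A) → P x → x ∈ L) × (+ length L ≡ c)

module _ {A : Set} where

  Count-empty : {P : A → Set} → (∀ x → ¬ P x) → Count P 0ℤ
  Count-empty none = [] , [] , [] , (λ x p → ⊥-elim (none x p)) , refl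

  Count-singleton : {P : A → Set} (x : A) → P x → (∀ y → P y → y ≡ x) → Count P 1ℤ
  Count-singleton x px uniq = x ∷ [] , px ∷ [] , [] ∷ [] , (λ y p → here (uniq y p)) , refl

  Count-⇔ : {P Q : A → Set} {c : ℤ} → (∀ x → P x → Q x) → (∀ x → Q x → P x) → Count P c → Count Q c
  Count-⇔ to from (L , all , uniq , complete , len) =
    L , All.map (to _) all , uniq , (λ x → complete x ∘ from x) , len

  Count-⊎ : {P Q : A → Set} {c d : ℤ} → (∀ x → P x → ¬ Q x) → Count P c → Count Q d →
    Count (λ x → P x ⊎ Q x) (c ℤ.+ d)
  Count-⊎ disjoint (L , all , uniq , complete , refl) (L′ , all′ , uniq′ , complete′ , refl) =
      L ++ L′
    , All.++⁺ (All.map inj₁ all) (All.map inj₂ all′)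
    , ++⁺ uniq uniq′ (λ (x∈L , x∈L′) → disjoint _ (All.lookup all x∈L) (All.lookup all′ x∈L′))
    , (λ { x (inj₁ p) → ∈-++⁺ˡ (complete x p) ; x (inj₂ q) → ∈-++⁺ʳ L (complete′ x q) })
    , trans (cong +_ (length-++ L)) (ℤ.pos-+ (length L) (length L′))

  -- `f` and `g` are mutually inverse only on `P` and `Q`, so uniqueness of the mapped list has to
  -- carry the proofs of `P` along in order to cancel `f`.
  Count-image : {P Q : A → Set} {c : ℤ} (f g : A → A) → (∀ x → P x → Q (f x)) →
    (∀ x → P x → g (f x) ≡ x) → (∀ y → Q y → P (g y)) → (∀ y → Q y → f (g y) ≡ y) →
    Count P c → Count Q c
  Count-image {P} {Q} f g f-pres gf g-pres fg (L , all , uniq , complete , len) =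
      map f L
    , All.map⁺ (All.map (f-pres _) all)
    , unique-map L all uniq
    , (λ y q → subst (_∈ map f L) (fg y q) (∈-map⁺ f (complete (g y) (g-pres y q))))
    , trans (cong +_ (length-map f L)) len
    where
    fresh : ∀ x → P x → ∀ L → All P L → All (x ≢_) L → All (f x ≢_) (map f L)
    fresh x px []      _          _          = []
    fresh x px (y ∷ L) (py ∷ all) (x≢y ∷ nx) =
      (λ fx≡fy → x≢y (trans (sym (gf x px)) (trans (cong g fx≡fy) (gf y py)))) ∷ fresh x px L all nx
    unique-map : ∀ L → All P L → Unique L → Unique (map f L)
    unique-map []      _          _         = []
    unique-map (x ∷ L) (px ∷ all) (nx ∷ un) = fresh x px L all nx ∷ unique-map L all un

-- Adding and removing the first column of a Young diagram

part-≥-length : ∀ l j → length l ≤ j → part l j ≡ 0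
part-≥-length []      j       _       = refl
part-≥-length (x ∷ l) (suc j) (s≤s p) = part-≥-length l j p

part-pos : ∀ l j → All (0 <_) l → j < length l → 0 < part l j
part-pos (x ∷ l) zero    (px ∷ _) _       = px
part-pos (x ∷ l) (suc j) (_ ∷ pl) (s≤s p) = part-pos l j pl p

-- For partitions, in terms of conjugates: each column of `l` exceeds the corresponding column of
-- `m` by at most `k`.
Interlaced : ℕ → List ℕ → List ℕ → Set
Interlaced k l m = ∀ j → part l (j ℕ.+ k) ≤ part m j

-- Otherwise `l` has a positive part at index `length m + k`, while the part of `m` at index
-- `length m` is 0.
length-interlaced : ∀ k l m → All (0 <_) l → Interlaced k l m → length l ≤ length m ℕ.+ k
length-interlaced k l m pos int = ℕ.≮⇒≥ λ lt → ℕ.<⇒≱ (part-pos l _ pos lt)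
  (subst (part l (length m ℕ.+ k) ≤_) (part-≥-length m _ ℕ.≤-refl) (int (length m)))

-- Prepends a column of height a to the Young diagram of l.
bump : ℕ → List ℕ → List ℕ
bump zero    _       = []
bump (suc a) []      = 1 ∷ bump a []
bump (suc a) (x ∷ l) = suc x ∷ bump a l

-- Removes the first column of the Young diagram of l.
lower : List ℕ → List ℕ
lower []                = []
lower (zero ∷ _)        = []
lower (suc zero ∷ _)    = []
lower (suc (suc x) ∷ l) = suc x ∷ lower l

length-bump : ∀ a l → length (bump a l) ≡ a
length-bump zero    l       = refl
length-bump (suc a) []      = cong suc (length-bump a [])
length-bump (suc a) (x ∷ l) = cong suc (length-bump a l)

length-lower : ∀ l → length (lower l) ≤ length l
length-lower []                = z≤n
length-lower (zero ∷ l)        = z≤n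
length-lower (suc zero ∷ l)    = z≤n
length-lower (suc (suc x) ∷ l) = s≤s (length-lower l)

sum-bump : ∀ a l → length l ≤ a → sum (bump a l) ≡ a ℕ.+ sum l
sum-bump zero    []      _       = refl
sum-bump (suc a) []      _       = cong suc (sum-bump a [] z≤n)
sum-bump (suc a) (x ∷ l) (s≤s p) = cong suc (trans (cong (x ℕ.+_) (sum-bump a l p))
  (trans (sym (ℕ.+-assoc x a _)) (trans (cong (ℕ._+ sum l) (ℕ.+-comm x a)) (ℕ.+-assoc a x _))))

part-bump-< : ∀ a l j → j < a → part (bump a l) j ≡ suc (part l j)
part-bump-< (suc a) []      zero    _       = refl
part-bump-< (suc a) []      (suc j) (s≤s p) = part-bump-< a [] j p
part-bump-< (suc a) (x ∷ l) zero    _       = refl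
part-bump-< (suc a) (x ∷ l) (suc j) (s≤s p) = part-bump-< a l j p

-- If `j + k` is inside the new column of `l`, then `j < b` and both parts grow by one; if it is
-- outside, the part of `bump a l` is 0.
bump-interlaced : ∀ k {a b} l m → a ≤ b ℕ.+ k → Interlaced k l m → Interlaced k (bump a l) (bump b m)
bump-interlaced k {a} {b} l m a≤b+k int j with j ℕ.+ k ℕ.<? a
... | yes j+k<a = subst₂ _≤_ (sym (part-bump-< a l (j ℕ.+ k) j+k<a))
  (sym (part-bump-< b m j (ℕ.+-cancelʳ-< k j b (ℕ.<-≤-trans j+k<a a≤b+k)))) (s≤s (int j))
... | no  j+k≮a = subst (_≤ part (bump b m) j)
  (sym (part-≥-length (bump a l) (j ℕ.+ k) (subst (_≤ j ℕ.+ k) (sym (length-bump a l)) (ℕ.≮⇒≥ j+k≮a)))) z≤n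

bump-partition : ∀ a l → IsPartition l → IsPartition (bump a l)
bump-partition a l (linked , _) = linked-bump a l linked , pos-bump a l
  where
  pos-bump : ∀ a l → All (0 <_) (bump a l)
  pos-bump zero    l       = []
  pos-bump (suc a) []      = z<s ∷ pos-bump a []
  pos-bump (suc a) (x ∷ l) = z<s ∷ pos-bump a l
  linked-bump : ∀ a l → Linked (λ x y → y ≤ x) l → Linked (λ x y → y ≤ x) (bump a l)
  linked-bump zero          l           _       = []
  linked-bump (suc zero)    []          _       = [-]
  linked-bump (suc zero)    (x ∷ l)     _       = [-]
  linked-bump (suc (suc a)) []          _       = ℕ.≤-refl ∷ linked-bump (suc a) [] []
  linked-bump (suc (suc a)) (x ∷ [])    _       = s≤s z≤n ∷ linked-bump (suc a) [] []
  linked-bump (suc (suc a)) (x ∷ y ∷ l) (p ∷ q) = s≤s p ∷ linked-bump (suc a) (y ∷ l) q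

tail-partition : ∀ {x l} → IsPartition (x ∷ l) → IsPartition l
tail-partition ([-] , _ ∷ pos)   = [] , pos
tail-partition (_ ∷ q , _ ∷ pos) = q , pos

part-≤-head : ∀ x l j → Linked (λ x y → y ≤ x) (x ∷ l) → part l j ≤ x
part-≤-head x []      j       _       = z≤n
part-≤-head x (y ∷ l) zero    (p ∷ _) = p
part-≤-head x (y ∷ l) (suc j) (p ∷ q) = ℕ.≤-trans (part-≤-head y l j q) p

-- `lower` stops at the first part equal to 1; by monotonicity the later parts are at most 1, so
-- their predecessors are 0.
part-lower : ∀ l j → IsPartition l → part (lower l) j ≡ pred (part l j)
part-lower []                j       _            = refl
part-lower (zero ∷ l)        j       (_ , () ∷ _)
part-lower (suc zero ∷ l)    zero    _            = refl
part-lower (suc zero ∷ l)    (suc j) (p , _)      = sym (ℕ.n≤0⇒n≡0 (ℕ.pred-mono-≤ (part-≤-head 1 l j p)))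
part-lower (suc (suc x) ∷ l) zero    _            = refl
part-lower (suc (suc x) ∷ l) (suc j) p            = part-lower l j (tail-partition p)

lower-interlaced : ∀ k l m → IsPartition l → IsPartition m → Interlaced k l m → Interlaced k (lower l) (lower m)
lower-interlaced k l m pl pm int j =
  subst₂ _≤_ (sym (part-lower l (j ℕ.+ k) pl)) (sym (part-lower m j pm)) (ℕ.pred-mono-≤ (int j))

lower-partition : ∀ l → IsPartition l → IsPartition (lower l)
lower-partition l (linked , _) = linked-lower l linked , pos-lower l
  where
  pos-lower : ∀ l → All (0 <_) (lower l)
  pos-lower []                = []
  pos-lower (zero ∷ l)        = []
  pos-lower (suc zero ∷ l)    = []
  pos-lower (suc (suc x) ∷ l) = z<s ∷ pos-lower l
  linked-lower : ∀ l → Linked (λ x y → y ≤ x) l → Linked (λ x y → y ≤ x) (lower l)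
  linked-lower []                _ = []
  linked-lower (zero ∷ l)        _ = []
  linked-lower (suc zero ∷ l)    _ = []
  linked-lower (suc (suc x) ∷ [])                _       = [-]
  linked-lower (suc (suc x) ∷ zero ∷ l)          _       = [-]
  linked-lower (suc (suc x) ∷ suc zero ∷ l)      _       = [-]
  linked-lower (suc (suc x) ∷ suc (suc y) ∷ l)   (p ∷ q) =
    s≤s⁻¹ p ∷ linked-lower (suc (suc y) ∷ l) q

bump-lower : ∀ l → IsPartition l → bump (length l) (lower l) ≡ l
bump-lower []                _            = refl
bump-lower (zero ∷ l)        (_ , () ∷ _)
bump-lower (suc zero ∷ l)    (p , _ ∷ pos) = cong (1 ∷_) (ones l p pos)
  where
  -- After a part 1 all parts are 1. `lower` has erased them, and padding with ones up to the old
  -- length restores them.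
  ones : ∀ l → Linked (λ x y → y ≤ x) (1 ∷ l) → All (0 <_) l → bump (length l) [] ≡ l
  ones []      _       _        = refl
  ones (y ∷ l) (p ∷ q) (0<y ∷ pos) with ℕ.≤-antisym p 0<y
  ... | refl = cong (1 ∷_) (ones l q pos)
bump-lower (suc (suc x) ∷ l) p            = cong (suc (suc x) ∷_) (bump-lower l (tail-partition p))

lower-bump : ∀ a l → length l ≤ a → All (0 <_) l → lower (bump a l) ≡ l
lower-bump zero    []          _       _         = refl
lower-bump (suc a) []          _       _         = refl
lower-bump (suc a) (suc x ∷ l) (s≤s p) (_ ∷ pos) = cong (suc x ∷_) (lower-bump a l p pos)

-- Peeling the first pair of columns off a cylindric partition

Pair : Set
Pair = Vec (List ℕ) 2

-- `next` sends index 0 to 1, where the profile is 0, and index 1 back to 0, where it is 3; hence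
-- the two shifts.
cylPart : ∀ {l m} → IsPartition l → IsPartition m → Interlaced 0 m l → Interlaced 3 l m →
  CylPart profile30 (l ∷ m ∷ [])
cylPart pl pm int₀ int₃ =
  (λ { fzero → pl ; (fsuc fzero) → pm }) , (λ { fzero → int₀ ; (fsuc fzero) → int₃ })

-- R constrains the numbers of parts of the two partitions, that is, the first pair of column heights.
Cyl : (ℕ → ℕ → Set) → ℕ → Pair → Set
Cyl R N (l ∷ m ∷ []) = CylPart profile30 (l ∷ m ∷ []) × size (l ∷ m ∷ []) ≡ N × R (length l) (length m)

Below Exactly : ℕ → ℕ → ℕ → ℕ → Set
Below a b m n = m ≤ a × n ≤ b
Exactly a b m n = m ≡ a × n ≡ b

Admissible : ℕ → ℕ → Set
Admissible a b = b ≤ a × a ≤ b ℕ.+ 3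

admissible-lengths : ∀ {l m} → CylPart profile30 (l ∷ m ∷ []) → Admissible (length l) (length m)
admissible-lengths {l} {m} (parts , ints) =
    subst (length m ≤_) (ℕ.+-identityʳ _)
      (length-interlaced 0 m l (proj₂ (parts (fsuc fzero))) (ints fzero))
  , length-interlaced 3 l m (proj₂ (parts fzero)) (ints (fsuc fzero))

bumpPair : ℕ → ℕ → Pair → Pair
bumpPair a b (l ∷ m ∷ []) = bump a l ∷ bump b m ∷ []

lowerPair : Pair → Pair
lowerPair (l ∷ m ∷ []) = lower l ∷ lower m ∷ []

size-bumpPair : ∀ a b l m → length l ≤ a → length m ≤ b →
  size (bump a l ∷ bump b m ∷ []) ≡ (a ℕ.+ b) ℕ.+ size (l ∷ m ∷ [])
size-bumpPair a b l m p q =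
  trans (cong₂ (λ s t → s ℕ.+ (t ℕ.+ 0)) (sum-bump a l p) (sum-bump b m q)) (lem a b (sum l) (sum m))
  where
  lem : ∀ a b x y → a ℕ.+ x ℕ.+ (b ℕ.+ y ℕ.+ 0) ≡ (a ℕ.+ b) ℕ.+ (x ℕ.+ (y ℕ.+ 0))
  lem = ℕ.solve-∀

-- Prepending columns of heights `a` and `b` is a bijection, inverse to removing the first columns,
-- and adds `a + b` to the size; admissibility of (a , b) keeps the result cylindric.
Count-Exactly : ∀ {a b c} → Admissible a b → ∀ N → Count (Cyl (Below a b) N) c →
  Count (Cyl (Exactly a b) (a ℕ.+ b ℕ.+ N)) c
Count-Exactly {a} {b} (b≤a , a≤b+3) N = Count-image (bumpPair a b) lowerPair bumped cancel lowered cancel′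
  where
  bumped : ∀ Λ → Cyl (Below a b) N Λ → Cyl (Exactly a b) (a ℕ.+ b ℕ.+ N) (bumpPair a b Λ)
  bumped (l ∷ m ∷ []) ((parts , ints) , refl , (p , q)) =
      cylPart (bump-partition a l (parts fzero)) (bump-partition b m (parts (fsuc fzero)))
        (bump-interlaced 0 m l (subst (b ≤_) (sym (ℕ.+-identityʳ a)) b≤a) (ints fzero))
        (bump-interlaced 3 l m a≤b+3 (ints (fsuc fzero)))
    , size-bumpPair a b l m p q
    , length-bump a l , length-bump b m
  cancel : ∀ Λ → Cyl (Below a b) N Λ → lowerPair (bumpPair a b Λ) ≡ Λ
  cancel (l ∷ m ∷ []) ((parts , _) , _ , (p , q)) =
    cong₂ (λ x y → x ∷ y ∷ []) (lower-bump a l p (proj₂ (parts fzero)))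
      (lower-bump b m q (proj₂ (parts (fsuc fzero))))
  cancel′ : ∀ Λ → Cyl (Exactly a b) (a ℕ.+ b ℕ.+ N) Λ → bumpPair a b (lowerPair Λ) ≡ Λ
  cancel′ (l ∷ m ∷ []) ((parts , _) , _ , (refl , refl)) =
    cong₂ (λ x y → x ∷ y ∷ []) (bump-lower l (parts fzero)) (bump-lower m (parts (fsuc fzero)))
  lowered : ∀ Λ → Cyl (Exactly a b) (a ℕ.+ b ℕ.+ N) Λ → Cyl (Below a b) N (lowerPair Λ)
  lowered (l ∷ m ∷ []) c@((parts , ints) , sz , (refl , refl)) =
      cylPart (lower-partition l (parts fzero)) (lower-partition m (parts (fsuc fzero)))
        (lower-interlaced 0 m l (parts (fsuc fzero)) (parts fzero) (ints fzero))
        (lower-interlaced 3 l m (parts fzero) (parts (fsuc fzero)) (ints (fsuc fzero)))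
    , ℕ.+-cancelˡ-≡ (length l ℕ.+ length m) _ _
        (trans (sym (size-bumpPair _ _ (lower l) (lower m) (length-lower l) (length-lower m)))
          (trans (cong size (cancel′ (l ∷ m ∷ []) c)) sz))
    , length-lower l , length-lower m

sum-≥-length : ∀ l → All (0 <_) l → length l ≤ sum l
sum-≥-length []      _           = z≤n
sum-≥-length (x ∷ l) (0<x ∷ pos) = ℕ.+-mono-≤ 0<x (sum-≥-length l pos)

size-≥-lengths : ∀ {l m} → CylPart profile30 (l ∷ m ∷ []) → length l ℕ.+ length m ≤ size (l ∷ m ∷ [])
size-≥-lengths {l} {m} (parts , _) = ℕ.+-mono-≤ (sum-≥-length l (proj₂ (parts fzero)))
  (ℕ.≤-trans (sum-≥-length m (proj₂ (parts (fsuc fzero)))) (ℕ.m≤m+n _ 0))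

Count-Exactly-small : ∀ {a b} N → N < a ℕ.+ b → Count (Cyl (Exactly a b) N) 0ℤ
Count-Exactly-small N N<a+b = Count-empty λ
  { (l ∷ m ∷ []) (cyl , refl , (refl , refl)) → ℕ.<⇒≱ N<a+b (size-≥-lengths cyl) }

-- Generating functions with a bound on the first pair of columns

Enumerates : FPS → (ℕ → ℕ → Set) → Set
Enumerates f R = ∀ N → Count (Cyl R N) (f N)

Enumerates-Exactly : ∀ {a b f} → Admissible a b → Enumerates f (Below a b) →
  Enumerates (qpow (a ℕ.+ b) ⊛ f) (Exactly a b)
Enumerates-Exactly {a} {b} {f} adm enum N with N ℕ.<? a ℕ.+ b
... | yes N<a+b = subst (Count _) (sym (qpow-⊛-< (a ℕ.+ b) f N N<a+b)) (Count-Exactly-small N N<a+b)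
... | no  N≮a+b with ℕ.m≤n⇒∃[o]m+o≡n (ℕ.≮⇒≥ N≮a+b)
... | M , refl = subst (Count _) (sym (qpow-⊛-+ (a ℕ.+ b) f M)) (Count-Exactly adm M (enum M))

Enumerates-⊎ : ∀ {R S f g} → (∀ m n → R m n → ¬ S m n) → Enumerates f R → Enumerates g S →
  Enumerates (f ⊕ g) (λ m n → R m n ⊎ S m n)
Enumerates-⊎ disjoint er es N = Count-⇔
  (λ { (l ∷ m ∷ []) (inj₁ (cyl , sz , r)) → cyl , sz , inj₁ r
     ; (l ∷ m ∷ []) (inj₂ (cyl , sz , s)) → cyl , sz , inj₂ s })
  (λ { (l ∷ m ∷ []) (cyl , sz , inj₁ r) → inj₁ (cyl , sz , r)
     ; (l ∷ m ∷ []) (cyl , sz , inj₂ s) → inj₂ (cyl , sz , s) })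
  (Count-⊎ (λ { (l ∷ m ∷ []) (_ , _ , r) (_ , _ , s) → disjoint _ _ r s }) (er N) (es N))

-- A pair with lengths below (a , b) either has exactly these lengths, and then removing its first
-- columns leaves a pair of the same kind, or satisfies R.
Enumerates-Below : ∀ {a b R f g} → Admissible a b → 0 < a ℕ.+ b → Enumerates g R →
  (∀ {m n} → Admissible m n → Below a b m n → R m n ⊎ Exactly a b m n) →
  (∀ {m n} → R m n → Below a b m n) → ¬ R a b →
  f ≈ g ⊕ qpow (a ℕ.+ b) ⊛ f → Enumerates f (Below a b)
-- The equation for `f` is recursive, but since `a + b` is positive its coefficient at `N` involves
-- `f` only below `N`; hence strong induction.
Enumerates-Below {a} {b} {R} {f} {g} adm 0<a+b enum split R⇒Below ¬Rab f≈ = <-rec _ step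
  where
  to : ∀ N Λ → Cyl R N Λ ⊎ Cyl (Exactly a b) N Λ → Cyl (Below a b) N Λ
  to N (l ∷ m ∷ []) (inj₁ (cyl , sz , r)) = cyl , sz , R⇒Below r
  to N (l ∷ m ∷ []) (inj₂ (cyl , sz , (refl , refl))) = cyl , sz , (ℕ.≤-refl , ℕ.≤-refl)
  from : ∀ N Λ → Cyl (Below a b) N Λ → Cyl R N Λ ⊎ Cyl (Exactly a b) N Λ
  from N (l ∷ m ∷ []) (cyl , sz , below) with split (admissible-lengths cyl) below
  ... | inj₁ r = inj₁ (cyl , sz , r)
  ... | inj₂ e = inj₂ (cyl , sz , e)
  disjoint : ∀ N Λ → Cyl R N Λ → ¬ Cyl (Exactly a b) N Λ
  disjoint N (l ∷ m ∷ []) (_ , _ , r) (_ , _ , (refl , refl)) = ¬Rab r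
  step : ∀ N → (∀ {M} → M < N → Count (Cyl (Below a b) M) (f M)) → Count (Cyl (Below a b) N) (f N)
  step N rec = Count-⇔ (to N) (from N)
    (subst (Count _) (sym (f≈ .at N)) (Count-⊎ (disjoint N) (enum N) exactly))
    where
    exactly : Count (Cyl (Exactly a b) N) ((qpow (a ℕ.+ b) ⊛ f) N)
    exactly with N ℕ.<? a ℕ.+ b
    ... | yes N<a+b = subst (Count _) (sym (qpow-⊛-< (a ℕ.+ b) f N N<a+b)) (Count-Exactly-small N N<a+b)
    ... | no  N≮a+b with ℕ.m≤n⇒∃[o]m+o≡n (ℕ.≮⇒≥ N≮a+b)
    ... | M , refl = subst (Count _) (sym (qpow-⊛-+ (a ℕ.+ b) f M))
      (Count-Exactly adm M (rec (ℕ.m<n+m M 0<a+b)))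

Enumerates-Below-0-0 : Enumerates one (Below 0 0)
Enumerates-Below-0-0 zero = Count-singleton ([] ∷ [] ∷ [])
  ( cylPart ([] , []) ([] , []) (λ _ → z≤n) (λ _ → z≤n) , refl , (z≤n , z≤n))
  (λ { ([] ∷ [] ∷ []) _ → refl
     ; ((_ ∷ _) ∷ _ ∷ []) (_ , _ , (() , _))
     ; ([] ∷ (_ ∷ _) ∷ []) (_ , _ , (_ , ())) })
Enumerates-Below-0-0 (suc N) = Count-empty
  (λ { ([] ∷ [] ∷ []) (_ , () , _)
     ; ((_ ∷ _) ∷ _ ∷ []) (_ , _ , (() , _))
     ; ([] ∷ (_ ∷ _) ∷ []) (_ , _ , (_ , ())) })

-- y s and z s belong to the middle and the extreme pair of weight s + 1; there is no extreme pair of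
-- weight 1, whence z 0 = 0.
y z : ℕ → FPS
y zero    = inv (one ⊖ qpow 1)
y (suc s) = (y s ⊕ qpow (suc s) ⊛ z s) ⊛ inv (one ⊖ qpow (suc (suc s)))
z zero    = 0S
z (suc s) = y s ⊛ inv (one ⊖ qpow (suc (suc s)))

-- Splits `one` as `(one ⊖ q) ⊕ q`; this is the fixed-point form that `Enumerates-Below` takes as a
-- hypothesis.
geometric : ∀ g s → g ⊛ inv (one ⊖ qpow (suc s)) ≈ g ⊕ qpow (suc s) ⊛ (g ⊛ inv (one ⊖ qpow (suc s)))
geometric g s = begin
  g ⊛ i                                  ≈⟨ solve 2 (λ g i → g :* i := g :* (con 1 :* i)) ≈-refl g i ⟩
  g ⊛ (one ⊛ i)                          ≈⟨ *-congˡ {g} (*-congʳ {i} (≈-sym (⊖-⊕ one q))) ⟩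
  g ⊛ (((one ⊖ q) ⊕ q) ⊛ i)              ≈⟨ solve 4 (λ g i d q → g :* ((d :+ q) :* i) := g :* (d :* i) :+ q :* (g :* i)) ≈-refl g i (one ⊖ q) q ⟩
  g ⊛ ((one ⊖ q) ⊛ i) ⊕ q ⊛ (g ⊛ i)      ≈⟨ +-congʳ {q ⊛ (g ⊛ i)} (*-congˡ {g} (⊛-inv (one ⊖ q) refl)) ⟩
  g ⊛ one ⊕ q ⊛ (g ⊛ i)                  ≈⟨ +-congʳ {q ⊛ (g ⊛ i)} (⊛-identityʳ g) ⟩
  g ⊕ q ⊛ (g ⊛ i)                        ∎
  where
  q = qpow (suc s)
  i = inv (one ⊖ q)

-- Unlike `i ℕ.+ i`, it reduces to two successors at `suc i`, so that `y`, `z` and `G` compute at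
-- `double (suc i)`.
double : ℕ → ℕ
double zero    = zero
double (suc i) = suc (suc (double i))

i+i≡double : ∀ i → i ℕ.+ i ≡ double i
i+i≡double zero    = refl
i+i≡double (suc i) = cong suc (trans (ℕ.+-suc i i) (cong suc (i+i≡double i)))

≤-suc-split : ∀ {m a} → m ≤ suc a → m ≤ a ⊎ m ≡ suc a
≤-suc-split p with ℕ.m≤n⇒m<n∨m≡n p
... | inj₁ q = inj₁ (s≤s⁻¹ q)
... | inj₂ e = inj₂ e

Enumerates-geometric : ∀ {a b R g} s → a ℕ.+ b ≡ suc s → Admissible a b → Enumerates g R →
  (∀ {m n} → Admissible m n → Below a b m n → R m n ⊎ Exactly a b m n) →
  (∀ {m n} → R m n → Below a b m n) → ¬ R a b →
  Enumerates (g ⊛ inv (one ⊖ qpow (suc s))) (Below a b)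
Enumerates-geometric {a} {b} {R} {g} s weight adm enum split R⇒Below ¬Rab =
  Enumerates-Below {R = R} {g = g} adm (subst (0 <_) (sym weight) z<s) enum split R⇒Below ¬Rab
    (subst (λ w → f ≈ g ⊕ qpow w ⊛ f) (sym weight) (geometric g s))
  where f = g ⊛ inv (one ⊖ qpow (suc s))

admissible : ∀ k i → k ≤ 3 → Admissible (k ℕ.+ i) i
admissible k i k≤3 = ℕ.m≤n+m i k , subst (_≤ i ℕ.+ 3) (ℕ.+-comm i k) (ℕ.+-monoʳ-≤ i k≤3)

weight : ∀ k i → k ℕ.+ i ℕ.+ i ≡ k ℕ.+ double i
weight k i = trans (ℕ.+-assoc k i i) (cong (k ℕ.+_) (i+i≡double i))

-- odd and even refer to the weight, which is one more than the index of y or z.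
Enumerates-y-odd : ∀ i → Enumerates (y (double i)) (Below (1 ℕ.+ i) i)
Enumerates-y-even : ∀ i → Enumerates (y (1 ℕ.+ double i)) (Below (2 ℕ.+ i) i)
Enumerates-z-even : ∀ i → Enumerates (z (1 ℕ.+ double i)) (Below (1 ℕ.+ i) (1 ℕ.+ i))
Enumerates-z-odd : ∀ i → Enumerates (z (2 ℕ.+ double i)) (Below (3 ℕ.+ i) i)

-- Gives the numerator of the recurrence for `y`: (a , b) is the middle and (c , d) the extreme pair
-- of the same weight `w`, and what lies strictly below the next middle pair is below the former or
-- starts exactly at the latter.
Enumerates-union : ∀ {g h a b c d w} → c ℕ.+ d ≡ w → Admissible c d →
  ¬ Below a b c d → Enumerates g (Below a b) → Enumerates h (Below c d) →
  Enumerates (g ⊕ qpow w ⊛ h) (λ m n → Below a b m n ⊎ Exactly c d m n)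
Enumerates-union {h = h} refl adm disj eg eh =
  Enumerates-⊎ (λ { m n below (refl , refl) → disj below }) eg (Enumerates-Exactly {f = h} adm eh)

Enumerates-z-even i = Enumerates-geometric _ (weight 0 (suc i)) (admissible 0 (suc i) z≤n)
  (Enumerates-y-odd i) split (λ (p , q) → p , ℕ.m≤n⇒m≤1+n q) (λ (_ , q) → ℕ.1+n≰n q)
  where
  -- The condition `n ≤ m` is decisive: as soon as n = i + 1, also m = i + 1.
  split : ∀ {m n} → Admissible m n → Below (1 ℕ.+ i) (1 ℕ.+ i) m n →
    Below (1 ℕ.+ i) i m n ⊎ Exactly (1 ℕ.+ i) (1 ℕ.+ i) m n
  split (n≤m , _) (p , q) with ≤-suc-split q
  ... | inj₁ n≤i  = inj₁ (p , n≤i)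
  ... | inj₂ refl = inj₂ (ℕ.≤-antisym p n≤m , refl)

Enumerates-z-odd i = Enumerates-geometric _ (weight 3 i) (admissible 3 i ℕ.≤-refl)
  (Enumerates-y-even i) split (λ (p , q) → ℕ.m≤n⇒m≤1+n p , q) (λ (p , _) → ℕ.1+n≰n p)
  where
  -- The condition `m ≤ n + 3` is decisive: m = i + 3 forces n = i.
  split : ∀ {m n} → Admissible m n → Below (3 ℕ.+ i) i m n →
    Below (2 ℕ.+ i) i m n ⊎ Exactly (3 ℕ.+ i) i m n
  split (_ , m≤n+3) (p , q) with ≤-suc-split p
  ... | inj₁ m≤i+2 = inj₁ (m≤i+2 , q)
  ... | inj₂ refl  = inj₂ (refl , ℕ.≤-antisym q (ℕ.+-cancelˡ-≤ 3 i _ (subst (3 ℕ.+ i ≤_) (ℕ.+-comm _ 3) m≤n+3)))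

Enumerates-y-odd zero = λ N → subst (Count _) (y₀ .at N) (enum N)
  where
  y₀ : one ⊛ y 0 ≈ y 0
  y₀ = ⊛-identityˡ (y 0)
  split : ∀ {m n} → Admissible m n → Below 1 0 m n → Below 0 0 m n ⊎ Exactly 1 0 m n
  split _ (p , q) with ≤-suc-split p
  ... | inj₁ m≤0  = inj₁ (m≤0 , q)
  ... | inj₂ refl = inj₂ (refl , ℕ.n≤0⇒n≡0 q)
  enum : Enumerates (one ⊛ y 0) (Below 1 0)
  enum = Enumerates-geometric 0 refl (admissible 1 0 (s≤s z≤n)) Enumerates-Below-0-0 split
    (λ (p , q) → ℕ.m≤n⇒m≤1+n p , q) (λ { (() , _) })
Enumerates-y-odd (suc i) = Enumerates-geometric _ (weight 1 (suc i)) (admissible 1 (suc i) (s≤s z≤n))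
  (Enumerates-union {h = z (1 ℕ.+ double i)} (weight 0 (suc i)) (admissible 0 (suc i) z≤n)
    (λ (_ , q) → ℕ.1+n≰n q) (Enumerates-y-even i) (Enumerates-z-even i))
  split
  (λ { (inj₁ (p , q)) → p , ℕ.m≤n⇒m≤1+n q ; (inj₂ (refl , refl)) → ℕ.n≤1+n _ , ℕ.≤-refl })
  (λ { (inj₁ (_ , q)) → ℕ.1+n≰n q ; (inj₂ (p , _)) → ℕ.1+n≢n p })
  where
  -- Once n = i + 1, the condition `n ≤ m` leaves only the extreme pair (i + 1 , i + 1) and the
  -- middle pair itself.
  split : ∀ {m n} → Admissible m n → Below (2 ℕ.+ i) (1 ℕ.+ i) m n →
    (Below (2 ℕ.+ i) i m n ⊎ Exactly (1 ℕ.+ i) (1 ℕ.+ i) m n) ⊎ Exactly (2 ℕ.+ i) (1 ℕ.+ i) m n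
  split (n≤m , _) (p , q) with ≤-suc-split q | ≤-suc-split p
  ... | inj₁ n≤i  | _          = inj₁ (inj₁ (p , n≤i))
  ... | inj₂ refl | inj₁ m≤i+1 = inj₁ (inj₂ (ℕ.≤-antisym m≤i+1 n≤m , refl))
  ... | inj₂ refl | inj₂ refl  = inj₂ (refl , refl)

Enumerates-y-even zero = λ N → subst (Count _) (y₁ .at N) (enum N)
  where
  r = inv (one ⊖ qpow 2)
  -- Weight 1 has no extreme pair, which is why the term with `z 0` vanishes.
  y₁ : y 0 ⊛ r ≈ y 1
  y₁ = *-congʳ {r} (≈-sym (≈-trans (+-congˡ {y 0} (⊛-zeroʳ (qpow 1))) (⊕-identityʳ (y 0))))
  split : ∀ {m n} → Admissible m n → Below 2 0 m n → Below 1 0 m n ⊎ Exactly 2 0 m n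
  split _ (p , q) with ≤-suc-split p
  ... | inj₁ m≤1  = inj₁ (m≤1 , q)
  ... | inj₂ refl = inj₂ (refl , ℕ.n≤0⇒n≡0 q)
  enum : Enumerates (y 0 ⊛ r) (Below 2 0)
  enum = Enumerates-geometric 1 refl (admissible 2 0 (s≤s (s≤s z≤n))) (Enumerates-y-odd 0) split
    (λ (p , q) → ℕ.m≤n⇒m≤1+n p , q) (λ { (s≤s () , _) })
Enumerates-y-even (suc i) = Enumerates-geometric _ (weight 2 (suc i)) (admissible 2 (suc i) (s≤s (s≤s z≤n)))
  (Enumerates-union {h = z (2 ℕ.+ double i)} (weight 3 i) (admissible 3 i ℕ.≤-refl)
    (λ (p , _) → ℕ.1+n≰n p) (Enumerates-y-odd (suc i)) (Enumerates-z-odd i))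
  split
  (λ { (inj₁ (p , q)) → ℕ.m≤n⇒m≤1+n p , q ; (inj₂ (refl , refl)) → ℕ.≤-refl , ℕ.n≤1+n _ })
  (λ { (inj₁ (p , _)) → ℕ.1+n≰n p ; (inj₂ (_ , q)) → ℕ.1+n≢n q })
  where
  -- Once m = i + 3, the condition `m ≤ n + 3` leaves only the extreme pair (i + 3 , i) and the
  -- middle pair itself.
  split : ∀ {m n} → Admissible m n → Below (3 ℕ.+ i) (1 ℕ.+ i) m n →
    (Below (2 ℕ.+ i) (1 ℕ.+ i) m n ⊎ Exactly (3 ℕ.+ i) i m n) ⊎ Exactly (3 ℕ.+ i) (1 ℕ.+ i) m n
  split (_ , m≤n+3) (p , q) with ≤-suc-split p | ≤-suc-split q
  ... | inj₁ m≤i+2 | _          = inj₁ (inj₁ (m≤i+2 , q))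
  ... | inj₂ refl  | inj₁ n≤i   = inj₁ (inj₂ (refl , ℕ.≤-antisym n≤i (ℕ.+-cancelˡ-≤ 3 i _ (subst (3 ℕ.+ i ≤_) (ℕ.+-comm _ 3) m≤n+3))))
  ... | inj₂ refl  | inj₂ refl  = inj₂ (refl , refl)

-- The q-series

inv-unique : ∀ {f g} → f 0 ≡ 1ℤ → f ⊛ g ≈ one → g ≈ inv f
inv-unique {f} {g} f0 fg≈1 = begin
  g                ≈⟨ ⊛-identityˡ g ⟨
  one ⊛ g          ≈⟨ *-congʳ {g} (⊛-inv f f0) ⟨
  (f ⊛ inv f) ⊛ g  ≈⟨ solve 3 (λ f i g → (f :* i) :* g := (f :* g) :* i) ≈-refl f (inv f) g ⟩
  (f ⊛ g) ⊛ inv f  ≈⟨ *-congʳ {inv f} fg≈1 ⟩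
  one ⊛ inv f      ≈⟨ ⊛-identityˡ (inv f) ⟩
  inv f            ∎

inv-cong : ∀ {f g} → g 0 ≡ 1ℤ → f ≈ g → inv f ≈ inv g
inv-cong {f} {g} g0 f≈g = inv-unique g0
  (≈-trans (*-congʳ {inv f} (≈-sym f≈g)) (⊛-inv f (trans (f≈g .at 0) g0)))

⊛-const : ∀ {f g} → f 0 ≡ 1ℤ → g 0 ≡ 1ℤ → (f ⊛ g) 0 ≡ 1ℤ
⊛-const {f} {g} f0 g0 = cong₂ (λ a b → a ℤ.* b ℤ.+ 0ℤ) f0 g0

inv-⊛ : ∀ {f g} → f 0 ≡ 1ℤ → g 0 ≡ 1ℤ → inv (f ⊛ g) ≈ inv f ⊛ inv g
inv-⊛ {f} {g} f0 g0 = ≈-sym (inv-unique (⊛-const {f} {g} f0 g0) (begin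
  (f ⊛ g) ⊛ (inv f ⊛ inv g) ≈⟨ solve 4 (λ f g i j → (f :* g) :* (i :* j) := (f :* i) :* (g :* j)) ≈-refl f g (inv f) (inv g) ⟩
  (f ⊛ inv f) ⊛ (g ⊛ inv g) ≈⟨ ⊛-cong (⊛-inv f f0) (⊛-inv g g0) ⟩
  one ⊛ one                 ≈⟨ ⊛-identityˡ one ⟩
  one                       ∎))

-- Expresses the reciprocal of a partial product by that of the next one, `c` being the new factor.
inv-cancel : ∀ {f g c} → f 0 ≡ 1ℤ → c 0 ≡ 1ℤ → g ≈ f ⊛ c → inv f ≈ c ⊛ inv g
inv-cancel {f} {g} {c} f0 c0 g≈fc = ≈-sym (inv-unique f0 (begin
  f ⊛ (c ⊛ inv g)  ≈⟨ ⊛-assoc f c (inv g) ⟨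
  (f ⊛ c) ⊛ inv g  ≈⟨ *-congʳ {inv g} g≈fc ⟨
  g ⊛ inv g        ≈⟨ ⊛-inv g (trans (g≈fc .at 0) (⊛-const {f} {c} f0 c0)) ⟩
  one              ∎))

qpow-cong : ∀ {m n} → m ≡ n → qpow m ≈ qpow n
qpow-cong refl = ≈-refl

powS-qpow : ∀ b n → powS (qpow b) n ≈ qpow (n ℕ.* b)
powS-qpow b zero    = ≈-sym qpow-zero
powS-qpow b (suc n) = begin
  powS (qpow b) n ⊛ qpow b  ≈⟨ *-congʳ {qpow b} (powS-qpow b n) ⟩
  qpow (n ℕ.* b) ⊛ qpow b   ≈⟨ qpow-⊛-qpow (n ℕ.* b) b ⟩
  qpow (n ℕ.* b ℕ.+ b)      ≈⟨ qpow-cong (ℕ.+-comm (n ℕ.* b) b) ⟩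
  qpow (b ℕ.+ n ℕ.* b)      ∎

qpow-⊛-powS : ∀ a b n → qpow a ⊛ powS (qpow b) n ≈ qpow (a ℕ.+ n ℕ.* b)
qpow-⊛-powS a b n = ≈-trans (*-congˡ {qpow a} (powS-qpow b n)) (qpow-⊛-qpow a (n ℕ.* b))

poch-suc : ∀ a b n → poch (qpow a) (qpow b) (suc n) ≈ poch (qpow a) (qpow b) n ⊛ (one ⊖ qpow (a ℕ.+ n ℕ.* b))
poch-suc a b n = *-congˡ {poch (qpow a) (qpow b) n} (+-congˡ {one} (-‿cong (qpow-⊛-powS a b n)))

poch-neg-suc : ∀ a b n →
  poch (neg (qpow a)) (qpow b) (suc n) ≈ poch (neg (qpow a)) (qpow b) n ⊛ (one ⊕ qpow (a ℕ.+ n ℕ.* b))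
poch-neg-suc a b n = *-congˡ {poch (neg (qpow a)) (qpow b) n} (+-congˡ {one} (begin
  neg (neg (qpow a) ⊛ p)  ≈⟨ -‿cong (-‿distribˡ-* (qpow a) p) ⟨
  neg (neg (qpow a ⊛ p))  ≈⟨ (coeffwise λ k → ℤ.neg-involutive ((qpow a ⊛ p) k)) ⟩
  qpow a ⊛ p              ≈⟨ qpow-⊛-powS a b n ⟩
  qpow (a ℕ.+ n ℕ.* b)    ∎))
  where p = powS (qpow b) n

poch-const : ∀ a b n → poch (qpow (suc a)) (qpow b) n 0 ≡ 1ℤ
poch-const a b zero    = refl
poch-const a b (suc n) = trans (poch-suc (suc a) b n .at 0) (cong (λ x → x ℤ.* 1ℤ ℤ.+ 0ℤ) (poch-const a b n))

poch-neg-const : ∀ a b n → poch (neg (qpow (suc a))) (qpow b) n 0 ≡ 1ℤ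
poch-neg-const a b zero    = refl
poch-neg-const a b (suc n) = trans (poch-neg-suc (suc a) b n .at 0) (cong (λ x → x ℤ.* 1ℤ ℤ.+ 0ℤ) (poch-neg-const a b n))

P2 M : ℕ → FPS
P2 = poch (qpow 2) (qpow 2)
M  = poch (neg (qpow 2)) (qpow 2)

one-minus-square : ∀ x → one ⊖ x ⊛ x ≈ (one ⊖ x) ⊛ (one ⊕ x)
one-minus-square x = ≈-sym (begin
  (one ⊖ x) ⊛ (one ⊕ x)          ≈⟨ solve 2 (λ x y → (con 1 :+ y) :* (con 1 :+ x) := con 1 :+ y :* x :+ (y :+ x)) ≈-refl x (neg x) ⟩
  one ⊕ neg x ⊛ x ⊕ (neg x ⊕ x)  ≈⟨ +-cong (+-congˡ {one} (≈-sym (-‿distribˡ-* x x))) (⊕-inverseˡ x) ⟩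
  one ⊖ x ⊛ x ⊕ 0S               ≈⟨ ⊕-identityʳ (one ⊖ x ⊛ x) ⟩
  one ⊖ x ⊛ x                    ∎)

-- Factorwise a difference of squares; it turns the denominators of the theorem into those of
-- `d 0 n`.
poch-4 : ∀ n → poch (qpow 4) (qpow 4) n ≈ P2 n ⊛ M n
poch-4 zero    = ≈-sym (⊛-identityˡ one)
poch-4 (suc n) = begin
  poch (qpow 4) (qpow 4) (suc n)                    ≈⟨ poch-suc 4 4 n ⟩
  poch (qpow 4) (qpow 4) n ⊛ (one ⊖ qpow (4 ℕ.+ n ℕ.* 4))
    ≈⟨ ⊛-cong (poch-4 n) (≈-trans (+-congˡ {one} (-‿cong (≈-sym square))) (one-minus-square x)) ⟩
  (P2 n ⊛ M n) ⊛ ((one ⊖ x) ⊛ (one ⊕ x))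
    ≈⟨ solve 4 (λ a b c d → (a :* b) :* (c :* d) := (a :* c) :* (b :* d)) ≈-refl (P2 n) (M n) (one ⊖ x) (one ⊕ x) ⟩
  (P2 n ⊛ (one ⊖ x)) ⊛ (M n ⊛ (one ⊕ x))            ≈⟨ ⊛-cong (poch-suc 2 2 n) (poch-neg-suc 2 2 n) ⟨
  P2 (suc n) ⊛ M (suc n)                            ∎
  where
  x = qpow (2 ℕ.+ n ℕ.* 2)
  lem : ∀ n → (2 ℕ.+ n ℕ.* 2) ℕ.+ (2 ℕ.+ n ℕ.* 2) ≡ 4 ℕ.+ n ℕ.* 4
  lem = ℕ.solve-∀
  square : x ⊛ x ≈ qpow (4 ℕ.+ n ℕ.* 4)
  square = ≈-trans (qpow-⊛-qpow (2 ℕ.+ n ℕ.* 2) (2 ℕ.+ n ℕ.* 2)) (qpow-cong (lem n))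

-- Sums of families of series

sumUpTo : (ℕ → ℤ) → ℕ → ℤ
sumUpTo f n = sumℤ (applyUpTo f n)

sumUpTo-cong : ∀ f g n → (∀ k → f k ≡ g k) → sumUpTo f n ≡ sumUpTo g n
sumUpTo-cong f g zero    p = refl
sumUpTo-cong f g (suc n) p = cong₂ ℤ._+_ (p 0) (sumUpTo-cong (λ k → f (suc k)) (λ k → g (suc k)) n λ k → p (suc k))

sumUpTo-+ : ∀ f g n → sumUpTo (λ k → f k ℤ.+ g k) n ≡ sumUpTo f n ℤ.+ sumUpTo g n
sumUpTo-+ f g zero    = refl
sumUpTo-+ f g (suc n) = trans
  (cong (ℤ._+_ (f 0 ℤ.+ g 0)) (sumUpTo-+ (λ k → f (suc k)) (λ k → g (suc k)) n))
  (lem (f 0) (g 0) _ _)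
  where
  lem : ∀ a b c d → (a ℤ.+ b) ℤ.+ (c ℤ.+ d) ≡ (a ℤ.+ c) ℤ.+ (b ℤ.+ d)
  lem = ℤ.solve-∀

sumUpTo-zero : ∀ f n → (∀ k → f k ≡ 0ℤ) → sumUpTo f n ≡ 0ℤ
sumUpTo-zero f zero    p = refl
sumUpTo-zero f (suc n) p = cong₂ ℤ._+_ (p 0) (sumUpTo-zero (λ k → f (suc k)) n λ k → p (suc k))

sumUpTo-extend : ∀ f m n → m ≤ n → (∀ k → m ≤ k → f k ≡ 0ℤ) → sumUpTo f n ≡ sumUpTo f m
sumUpTo-extend f zero    n       _       p = sumUpTo-zero f n λ k → p k z≤n
sumUpTo-extend f (suc m) (suc n) (s≤s l) p =
  cong (ℤ._+_ (f 0)) (sumUpTo-extend (λ k → f (suc k)) m n l λ k q → p (suc k) (s≤s q))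

-- F n = O(q^n), the condition under which sumSeries F is the sum of the family F.
Summable : (ℕ → FPS) → Set
Summable F = ∀ n k → k < n → F n k ≡ 0ℤ

sumSeries-cong : ∀ {F G} → (∀ n → F n ≈ G n) → sumSeries F ≈ sumSeries G
sumSeries-cong p .at N = sumUpTo-cong _ _ (suc N) λ n → p n .at N

sumSeries-⊕ : ∀ F G → sumSeries (λ n → F n ⊕ G n) ≈ sumSeries F ⊕ sumSeries G
sumSeries-⊕ F G .at N = sumUpTo-+ (λ n → F n N) (λ n → G n N) (suc N)

sumSeries-suc : ∀ F → Summable F → sumSeries F ≈ F 0 ⊕ sumSeries (λ n → F (suc n))
sumSeries-suc F small .at N = cong (ℤ._+_ (F 0 N))
  -- At q^N the shifted sum reaches `F (suc N)`, one term beyond the left side; summability makes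
  -- that term 0.
  (sym (sumUpTo-extend (λ n → F (suc n) N) N (suc N) (ℕ.n≤1+n N) λ k N≤k → small (suc k) N (s≤s N≤k)))

sumSeries-qpow : ∀ m F → Summable F → sumSeries (λ n → qpow m ⊛ F n) ≈ qpow m ⊛ sumSeries F
sumSeries-qpow m F small .at N with N ℕ.<? m
... | yes N<m = trans (sumUpTo-zero _ (suc N) λ n → qpow-⊛-< m (F n) N N<m) (sym (qpow-⊛-< m (sumSeries F) N N<m))
... | no  N≮m with ℕ.m≤n⇒∃[o]m+o≡n (ℕ.≮⇒≥ N≮m)
... | k , refl = trans (sumUpTo-cong _ _ (suc (m ℕ.+ k)) λ n → qpow-⊛-+ m (F n) k)
  (trans (sumUpTo-extend (λ n → F n k) (suc k) (suc (m ℕ.+ k)) (s≤s (ℕ.m≤n+m k m)) λ n → small n k)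
    (sym (qpow-⊛-+ m (sumSeries F) k)))

-- The series `U` and `V` and their recurrences

d u v : ℕ → ℕ → FPS
d i n = inv (P2 n) ⊛ inv (M (i ℕ.+ n))
u i n = qpow (n ℕ.* n ℕ.+ 2 ℕ.* n ℕ.+ double i ℕ.* n) ⊛ d i n
v i n = qpow (n ℕ.* n ℕ.+ double i ℕ.* n) ⊛ d i n

U V : ℕ → FPS
U i = sumSeries (u i)
V i = sumSeries (v i)

n≤n*n : ∀ n → n ≤ n ℕ.* n
n≤n*n zero    = z≤n
n≤n*n (suc n) = ℕ.m≤m*n (suc n) (suc n)

Summable-u : ∀ i → Summable (u i)
Summable-u i n k k<n = qpow-⊛-< _ (d i n) k (ℕ.<-≤-trans k<n
  (ℕ.≤-trans (n≤n*n n) (ℕ.≤-trans (ℕ.m≤m+n _ _) (ℕ.m≤m+n _ _))))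

Summable-v : ∀ i → Summable (v i)
Summable-v i n k k<n = qpow-⊛-< _ (d i n) k (ℕ.<-≤-trans k<n (ℕ.≤-trans (n≤n*n n) (ℕ.m≤m+n _ _)))

inv-P2-suc : ∀ n → inv (P2 (suc n)) ≈ inv (P2 n) ⊕ qpow (2 ℕ.+ n ℕ.* 2) ⊛ inv (P2 (suc n))
inv-P2-suc n = begin
  j                           ≈⟨ ⊖-⊕ j (q ⊛ j) ⟨
  (j ⊕ neg (q ⊛ j)) ⊕ q ⊛ j   ≈⟨ +-congʳ {q ⊛ j} (begin
    j ⊕ neg (q ⊛ j)               ≈⟨ +-cong (⊛-identityˡ j) (≈-sym (-‿distribˡ-* q j)) ⟨
    one ⊛ j ⊕ neg q ⊛ j           ≈⟨ ⊛-distribʳ j one (neg q) ⟨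
    (one ⊖ q) ⊛ j                 ≈⟨ inv-cancel {c = one ⊖ q} (poch-const 1 2 n) refl (poch-suc 2 2 n) ⟨
    inv (P2 n)                    ∎) ⟩
  inv (P2 n) ⊕ q ⊛ j          ∎
  where
  q = qpow (2 ℕ.+ n ℕ.* 2)
  j = inv (P2 (suc n))

-- Splits off the last factor of `P2 (suc n)`; `i` rises because `M (i + suc n)` is `M (suc i + n)`.
d-suc : ∀ i n → d i (suc n) ≈ d (suc i) n ⊕ qpow (2 ℕ.+ n ℕ.* 2) ⊛ d i (suc n)
d-suc i n = begin
  inv (P2 (suc n)) ⊛ m            ≈⟨ *-congʳ {m} (inv-P2-suc n) ⟩
  (inv (P2 n) ⊕ q ⊛ j) ⊛ m        ≈⟨ solve 4 (λ p q j m → (p :+ q :* j) :* m := p :* m :+ q :* (j :* m)) ≈-refl (inv (P2 n)) q j m ⟩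
  inv (P2 n) ⊛ m ⊕ q ⊛ (j ⊛ m)    ≈⟨ +-congʳ {q ⊛ (j ⊛ m)} (*-congˡ {inv (P2 n)} (≈-reflexive (cong (λ k → inv (M k)) (ℕ.+-suc i n)))) ⟩
  d (suc i) n ⊕ q ⊛ (j ⊛ m)       ∎
  where
  q = qpow (2 ℕ.+ n ℕ.* 2)
  j = inv (P2 (suc n))
  m = inv (M (i ℕ.+ suc n))

-- Splits off the last factor of `M (suc i + n)`.
d-sucˡ : ∀ i n → d i n ≈ d (suc i) n ⊕ qpow (2 ℕ.+ (i ℕ.+ n) ℕ.* 2) ⊛ d (suc i) n
d-sucˡ i n = begin
  p ⊛ inv (M (i ℕ.+ n))
    ≈⟨ *-congˡ {p} (inv-cancel {c = one ⊕ q} (poch-neg-const 1 2 (i ℕ.+ n)) refl (poch-neg-suc 2 2 (i ℕ.+ n))) ⟩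
  p ⊛ ((one ⊕ q) ⊛ m)
    ≈⟨ solve 3 (λ p q m → p :* ((con 1 :+ q) :* m) := p :* m :+ q :* (p :* m)) ≈-refl p q m ⟩
  p ⊛ m ⊕ q ⊛ (p ⊛ m)             ∎
  where
  p = inv (P2 n)
  q = qpow (2 ℕ.+ (i ℕ.+ n) ℕ.* 2)
  m = inv (M (suc i ℕ.+ n))

-- Exponent bookkeeping for `u-rec` and `v-suc`: `w` collects the part that does not depend on the
-- summation index and can leave the sum.
qpow-⊛-split : ∀ e {e₁} e₂ w x f g h → e ≡ e₁ → e ℕ.+ x ≡ w ℕ.+ e₂ → f ≈ g ⊕ qpow x ⊛ h →
  qpow e ⊛ f ≈ qpow e₁ ⊛ g ⊕ qpow w ⊛ (qpow e₂ ⊛ h)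
qpow-⊛-split e e₂ w x f g h refl eq f≈ = begin
  qpow e ⊛ f                             ≈⟨ *-congˡ {qpow e} f≈ ⟩
  qpow e ⊛ (g ⊕ qpow x ⊛ h)
    ≈⟨ solve 4 (λ e g x h → e :* (g :+ x :* h) := e :* g :+ (e :* x) :* h) ≈-refl (qpow e) g (qpow x) h ⟩
  qpow e ⊛ g ⊕ (qpow e ⊛ qpow x) ⊛ h
    ≈⟨ +-congˡ {qpow e ⊛ g} (*-congʳ {h} (≈-trans (qpow-⊛-qpow e x) (≈-trans (qpow-cong eq) (≈-sym (qpow-⊛-qpow w e₂))))) ⟩
  qpow e ⊛ g ⊕ (qpow w ⊛ qpow e₂) ⊛ h    ≈⟨ +-congˡ {qpow e ⊛ g} (⊛-assoc (qpow w) (qpow e₂) h) ⟩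
  qpow e ⊛ g ⊕ qpow w ⊛ (qpow e₂ ⊛ h)    ∎

u-rec : ∀ i n → u i n ≈ v (suc i) n ⊕ qpow (2 ℕ.+ double i) ⊛ u (suc i) n
u-rec i n = qpow-⊛-split (n ℕ.* n ℕ.+ 2 ℕ.* n ℕ.+ double i ℕ.* n)
  (n ℕ.* n ℕ.+ 2 ℕ.* n ℕ.+ double (suc i) ℕ.* n) (2 ℕ.+ double i) (2 ℕ.+ (i ℕ.+ n) ℕ.* 2)
  (d i n) (d (suc i) n) (d (suc i) n) (e₁ n (double i))
  (subst (λ x → n ℕ.* n ℕ.+ 2 ℕ.* n ℕ.+ x ℕ.* n ℕ.+ (2 ℕ.+ (i ℕ.+ n) ℕ.* 2)
      ≡ 2 ℕ.+ x ℕ.+ (n ℕ.* n ℕ.+ 2 ℕ.* n ℕ.+ (2 ℕ.+ x) ℕ.* n)) (i+i≡double i) (e₂ n i))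
  (d-sucˡ i n)
  where
  e₁ : ∀ n x → n ℕ.* n ℕ.+ 2 ℕ.* n ℕ.+ x ℕ.* n ≡ n ℕ.* n ℕ.+ (2 ℕ.+ x) ℕ.* n
  e₁ = ℕ.solve-∀
  e₂ : ∀ n i → n ℕ.* n ℕ.+ 2 ℕ.* n ℕ.+ (i ℕ.+ i) ℕ.* n ℕ.+ (2 ℕ.+ (i ℕ.+ n) ℕ.* 2)
    ≡ 2 ℕ.+ (i ℕ.+ i) ℕ.+ (n ℕ.* n ℕ.+ 2 ℕ.* n ℕ.+ (2 ℕ.+ (i ℕ.+ i)) ℕ.* n)
  e₂ = ℕ.solve-∀

-- In `d-suc` the power 2n + 2 turns `v i (suc n)` into `u i (suc n)`. The rest is a term of index
-- `n`, because (n + 1)² + 2i(n + 1) = (2i + 1) + n² + (2i + 2)n.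
v-suc : ∀ i n → v i (suc n) ≈ u i (suc n) ⊕ qpow (1 ℕ.+ double i) ⊛ v (suc i) n
v-suc i n = begin
  qpow e ⊛ d i (suc n)                ≈⟨ *-congˡ {qpow e} (begin
    d i (suc n)                                       ≈⟨ d-suc i n ⟩
    d (suc i) n ⊕ qpow x ⊛ d i (suc n)                ≈⟨ ⊕-comm (d (suc i) n) (qpow x ⊛ d i (suc n)) ⟩
    qpow x ⊛ d i (suc n) ⊕ d (suc i) n                ≈⟨ +-congˡ {qpow x ⊛ d i (suc n)} (⊛-identityˡ (d (suc i) n)) ⟨
    qpow x ⊛ d i (suc n) ⊕ one ⊛ d (suc i) n          ≈⟨ +-congˡ {qpow x ⊛ d i (suc n)} (*-congʳ {d (suc i) n} qpow-zero) ⟨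
    qpow x ⊛ d i (suc n) ⊕ qpow 0 ⊛ d (suc i) n       ∎) ⟩
  qpow e ⊛ (qpow x ⊛ d i (suc n) ⊕ qpow 0 ⊛ d (suc i) n)
    ≈⟨ qpow-⊛-split e (n ℕ.* n ℕ.+ double (suc i) ℕ.* n) (1 ℕ.+ double i) 0
         (qpow x ⊛ d i (suc n) ⊕ qpow 0 ⊛ d (suc i) n) (qpow x ⊛ d i (suc n)) (d (suc i) n) refl (e₁ n (double i)) ≈-refl ⟩
  qpow e ⊛ (qpow x ⊛ d i (suc n)) ⊕ qpow (1 ℕ.+ double i) ⊛ v (suc i) n
    ≈⟨ +-congʳ {qpow (1 ℕ.+ double i) ⊛ v (suc i) n} (≈-trans (≈-sym (⊛-assoc (qpow e) (qpow x) (d i (suc n))))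
         (*-congʳ {d i (suc n)} (≈-trans (qpow-⊛-qpow e x) (qpow-cong (e₂ n (double i)))))) ⟩
  u i (suc n) ⊕ qpow (1 ℕ.+ double i) ⊛ v (suc i) n ∎
  where
  e = suc n ℕ.* suc n ℕ.+ double i ℕ.* suc n
  x = 2 ℕ.+ n ℕ.* 2
  e₁ : ∀ n y → suc n ℕ.* suc n ℕ.+ y ℕ.* suc n ℕ.+ 0 ≡ 1 ℕ.+ y ℕ.+ (n ℕ.* n ℕ.+ (2 ℕ.+ y) ℕ.* n)
  e₁ = ℕ.solve-∀
  e₂ : ∀ n y → suc n ℕ.* suc n ℕ.+ y ℕ.* suc n ℕ.+ (2 ℕ.+ n ℕ.* 2) ≡ suc n ℕ.* suc n ℕ.+ 2 ℕ.* suc n ℕ.+ y ℕ.* suc n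
  e₂ = ℕ.solve-∀

U-rec : ∀ i → U i ≈ V (suc i) ⊕ qpow (2 ℕ.+ double i) ⊛ U (suc i)
U-rec i = begin
  U i                                                          ≈⟨ sumSeries-cong (u-rec i) ⟩
  sumSeries (λ n → v (suc i) n ⊕ q ⊛ u (suc i) n)              ≈⟨ sumSeries-⊕ (v (suc i)) (λ n → q ⊛ u (suc i) n) ⟩
  V (suc i) ⊕ sumSeries (λ n → q ⊛ u (suc i) n)                ≈⟨ +-congˡ {V (suc i)} (sumSeries-qpow (2 ℕ.+ double i) (u (suc i)) (Summable-u (suc i))) ⟩
  V (suc i) ⊕ q ⊛ U (suc i)                                    ∎
  where q = qpow (2 ℕ.+ double i)

V-rec : ∀ i → V i ≈ U i ⊕ qpow (1 ℕ.+ double i) ⊛ V (suc i)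
V-rec i = begin
  V i                                                          ≈⟨ sumSeries-suc (v i) (Summable-v i) ⟩
  v i 0 ⊕ sumSeries (λ n → v i (suc n))                        ≈⟨ +-congˡ {v i 0} (sumSeries-cong (v-suc i)) ⟩
  v i 0 ⊕ sumSeries (λ n → u i (suc n) ⊕ q ⊛ v (suc i) n)      ≈⟨ +-congˡ {v i 0} (sumSeries-⊕ (λ n → u i (suc n)) (λ n → q ⊛ v (suc i) n)) ⟩
  v i 0 ⊕ (sumSeries (λ n → u i (suc n)) ⊕ sumSeries (λ n → q ⊛ v (suc i) n))
    ≈⟨ ⊕-assoc (v i 0) (sumSeries (λ n → u i (suc n))) (sumSeries (λ n → q ⊛ v (suc i) n)) ⟨
  -- The terms `v i 0` and `u i 0` are definitionally equal, so the series of `U i` is complete.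
  (u i 0 ⊕ sumSeries (λ n → u i (suc n))) ⊕ sumSeries (λ n → q ⊛ v (suc i) n)
    ≈⟨ +-cong (≈-sym (sumSeries-suc (u i) (Summable-u i))) (sumSeries-qpow (1 ℕ.+ double i) (v (suc i)) (Summable-v (suc i))) ⟩
  U i ⊕ q ⊛ V (suc i)                                          ∎
  where q = qpow (1 ℕ.+ double i)

-- G i = U i , V (i + 1) , U (i + 1) , V (i + 2) , …
G : ℕ → ℕ → FPS
G i zero          = U i
G i (suc zero)    = V (suc i)
G i (suc (suc s)) = G (suc i) s

-- `U-rec` and `V-rec` alternate, and the exponent grows by one at each step, so they form a single
-- three-term recurrence.
G-rec : ∀ i s → G i s ≈ G i (suc s) ⊕ qpow (2 ℕ.+ (double i ℕ.+ s)) ⊛ G i (suc (suc s))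
G-rec i zero          = subst (λ w → U i ≈ V (suc i) ⊕ qpow (2 ℕ.+ w) ⊛ U (suc i)) (sym (ℕ.+-identityʳ (double i))) (U-rec i)
G-rec i (suc zero)    = subst (λ w → V (suc i) ≈ U (suc i) ⊕ qpow (2 ℕ.+ w) ⊛ V (suc (suc i))) (ℕ.+-comm 1 (double i)) (V-rec (suc i))
G-rec i (suc (suc s)) = subst (λ w → G (suc i) s ≈ G (suc i) (suc s) ⊕ qpow (2 ℕ.+ w) ⊛ G (suc i) (suc (suc s)))
  (sym (trans (ℕ.+-suc (double i) (suc s)) (cong suc (ℕ.+-suc (double i) s)))) (G-rec (suc i) s)

G-double : ∀ i j → G i (double j) ≡ U (i ℕ.+ j)
G-double i zero    = cong U (sym (ℕ.+-identityʳ i))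
G-double i (suc j) = trans (G-double (suc i) j) (cong U (sym (ℕ.+-suc i j)))

-- The expansion of `U 0`

Pq : ℕ → FPS
Pq = poch (qpow 1) (qpow 1)

Pq-suc : ∀ s → Pq (suc s) ≈ Pq s ⊛ (one ⊖ qpow (suc s))
Pq-suc s = subst (λ w → Pq (suc s) ≈ Pq s ⊛ (one ⊖ qpow (suc w))) (ℕ.*-identityʳ s) (poch-suc 1 1 s)

-- After `G-rec` is applied to `G 0 s`, the coefficients of the next two terms are the numerators of
-- `y (suc s)` and `z (suc s)`; the new factor of `Pq` cancels their common denominator.
U₀-expansion : ∀ s → U 0 ≈ Pq (suc s) ⊛ (y s ⊛ G 0 s ⊕ qpow (suc s) ⊛ (z s ⊛ G 0 (suc s)))
U₀-expansion zero = ≈-sym (begin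
  Pq 1 ⊛ (y 0 ⊛ U 0 ⊕ qpow 1 ⊛ (0S ⊛ V 1))
    ≈⟨ ⊛-cong (≈-trans (Pq-suc 0) (⊛-identityˡ c)) (+-congˡ {y 0 ⊛ U 0} (≈-trans (*-congˡ {qpow 1} (⊛-zeroˡ (V 1))) (⊛-zeroʳ (qpow 1)))) ⟩
  c ⊛ (y 0 ⊛ U 0 ⊕ 0S)     ≈⟨ solve 3 (λ c i g → c :* (i :* g :+ con 0) := (c :* i) :* g) ≈-refl c (inv c) (U 0) ⟩
  (c ⊛ inv c) ⊛ U 0        ≈⟨ *-congʳ {U 0} (⊛-inv c refl) ⟩
  one ⊛ U 0                ≈⟨ ⊛-identityˡ (U 0) ⟩
  U 0                      ∎)
  where c = one ⊖ qpow 1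
U₀-expansion (suc s) = begin
  U 0                                                   ≈⟨ U₀-expansion s ⟩
  p ⊛ (y s ⊛ G 0 s ⊕ q ⊛ (z s ⊛ g₁))                    ≈⟨ *-congˡ {p} (+-congʳ {q ⊛ (z s ⊛ g₁)} (*-congˡ {y s} (G-rec 0 s))) ⟩
  p ⊛ (y s ⊛ (g₁ ⊕ q′ ⊛ g₂) ⊕ q ⊛ (z s ⊛ g₁))
    ≈⟨ solve 7 (λ p y z g₁ g₂ q q′ → p :* (y :* (g₁ :+ q′ :* g₂) :+ q :* (z :* g₁))
         := (con 1 :* p) :* ((y :+ q :* z) :* g₁ :+ q′ :* (y :* g₂))) ≈-refl p (y s) (z s) g₁ g₂ q q′ ⟩
  (one ⊛ p) ⊛ (w ⊛ g₁ ⊕ q′ ⊛ (y s ⊛ g₂))                ≈⟨ *-congʳ {w ⊛ g₁ ⊕ q′ ⊛ (y s ⊛ g₂)} (*-congʳ {p} (⊛-inv c refl)) ⟨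
  ((c ⊛ inv c) ⊛ p) ⊛ (w ⊛ g₁ ⊕ q′ ⊛ (y s ⊛ g₂))
    ≈⟨ solve 8 (λ c i p w y g₁ g₂ q′ → ((c :* i) :* p) :* (w :* g₁ :+ q′ :* (y :* g₂))
         := (p :* c) :* ((w :* i) :* g₁ :+ q′ :* ((y :* i) :* g₂))) ≈-refl c (inv c) p w (y s) g₁ g₂ q′ ⟩
  (p ⊛ c) ⊛ (y (suc s) ⊛ g₁ ⊕ q′ ⊛ (z (suc s) ⊛ g₂))    ≈⟨ *-congʳ {y (suc s) ⊛ g₁ ⊕ q′ ⊛ (z (suc s) ⊛ g₂)} (Pq-suc (suc s)) ⟨
  Pq (suc (suc s)) ⊛ (y (suc s) ⊛ g₁ ⊕ q′ ⊛ (z (suc s) ⊛ g₂)) ∎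
  where
  p = Pq (suc s)
  q = qpow (suc s)
  q′ = qpow (suc (suc s))
  c = one ⊖ q′
  g₁ = G 0 (suc s)
  g₂ = G 0 (suc (suc s))
  w = y s ⊕ q ⊛ z s

-- Congruence modulo q^(N+1)

module UpTo (N : ℕ) where

  infix 4 _∼_
  record _∼_ (f g : FPS) : Set where
    constructor upTo
    field coeff : ∀ k → k ≤ N → f k ≡ g k
  open _∼_ public

  ≈⇒∼ : ∀ {f g} → f ≈ g → f ∼ g
  ≈⇒∼ p .coeff k _ = p .at k

  ∼-sym : ∀ {f g} → f ∼ g → g ∼ f
  ∼-sym p .coeff k l = sym (p .coeff k l)

  ∼-trans : ∀ {f g h} → f ∼ g → g ∼ h → f ∼ h
  ∼-trans p q .coeff k l = trans (p .coeff k l) (q .coeff k l)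

  ⊛-cong-∼ : ∀ {f f′ g g′} → f ∼ f′ → g ∼ g′ → f ⊛ g ∼ f′ ⊛ g′
  ⊛-cong-∼ {f} {f′} {g} {g′} p q .coeff k k≤N = ⊛-cong-upto f f′ g g′ k
    (λ j j≤k → p .coeff j (ℕ.≤-trans j≤k k≤N)) (λ j j≤k → q .coeff j (ℕ.≤-trans j≤k k≤N))

  -- Reduces to products: 1/f = (1/f) g (1/g), where `g` may be replaced by `f`.
  inv-cong-∼ : ∀ {f g} → f 0 ≡ 1ℤ → g 0 ≡ 1ℤ → f ∼ g → inv f ∼ inv g
  inv-cong-∼ {f} {g} f0 g0 p = ∼-trans (≈⇒∼ left)
    (∼-trans (⊛-cong-∼ {inv f ⊛ g} {inv f ⊛ f} {inv g} (⊛-cong-∼ {inv f} (≈⇒∼ ≈-refl) (∼-sym p)) (≈⇒∼ ≈-refl)) (≈⇒∼ right))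
    where
    left : inv f ≈ (inv f ⊛ g) ⊛ inv g
    left = begin
      inv f                ≈⟨ ⊛-identityʳ (inv f) ⟨
      inv f ⊛ one          ≈⟨ *-congˡ {inv f} (⊛-inv g g0) ⟨
      inv f ⊛ (g ⊛ inv g)  ≈⟨ ⊛-assoc (inv f) g (inv g) ⟨
      (inv f ⊛ g) ⊛ inv g  ∎
    right : (inv f ⊛ f) ⊛ inv g ≈ inv g
    right = ≈-trans (*-congʳ {inv g} (≈-trans (⊛-comm (inv f) f) (⊛-inv f f0))) (⊛-identityˡ (inv g))

  drop-qpow : ∀ e f g → N < e → f ⊕ qpow e ⊛ g ∼ f
  drop-qpow e f g N<e .coeff k k≤N =
    trans (cong (ℤ._+_ (f k)) (qpow-⊛-< e g k (ℕ.≤-<-trans k≤N N<e))) (ℤ.+-identityʳ (f k))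

-- Partial products p n whose n-th factor is 1 + O(q^(n+1)); the coefficient of q^k is final from p k on.
module _ (p : ℕ → FPS) (r : ℕ → FPS) (e : ℕ → ℕ) (e> : ∀ n → n < e n)
         (p-suc : ∀ n → p (suc n) ≈ p n ⊕ qpow (e n) ⊛ r n) where

  stable : ∀ k j → p (j ℕ.+ k) k ≡ p k k
  stable k zero    = refl
  stable k (suc j) = trans (p-suc (j ℕ.+ k) .at k)
    (trans (UpTo.drop-qpow k (e (j ℕ.+ k)) (p (j ℕ.+ k)) (r (j ℕ.+ k)) (ℕ.≤-<-trans (ℕ.m≤n+m k j) (e> _)) .UpTo._∼_.coeff k ℕ.≤-refl)
      (stable k j))

  stable-≤ : ∀ {k m} → k ≤ m → p m k ≡ p k k
  stable-≤ {k} {m} k≤m = subst (λ n → p n k ≡ p k k) (ℕ.m∸n+n≡m k≤m) (stable k (m ∸ k))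

Pq-stable : ∀ {k m} → k ≤ m → Pq m k ≡ Pq k k
Pq-stable = stable-≤ Pq (λ n → neg (Pq n)) suc (λ n → ℕ.≤-refl) λ n →
  ≈-trans (Pq-suc n) (split (Pq n) (qpow (suc n)))
  where
  split : ∀ p q → p ⊛ (one ⊖ q) ≈ p ⊕ q ⊛ neg p
  split p q = begin
    p ⊛ (one ⊕ neg q)  ≈⟨ solve 2 (λ p q → p :* (con 1 :+ q) := p :+ p :* q) ≈-refl p (neg q) ⟩
    p ⊕ p ⊛ neg q      ≈⟨ +-congˡ {p} (≈-trans (≈-sym (-‿distribʳ-* p q)) (≈-trans (-‿cong (⊛-comm p q)) (-‿distribʳ-* q p))) ⟩
    p ⊕ q ⊛ neg p      ∎

M-stable : ∀ {k m} → k ≤ m → M m k ≡ M k k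
M-stable = stable-≤ M M (λ n → 2 ℕ.+ n ℕ.* 2) (λ n → s≤s (ℕ.≤-trans (ℕ.m≤m*n n 2) (ℕ.n≤1+n _))) λ n →
  ≈-trans (poch-neg-suc 2 2 n) (solve 2 (λ p q → p :* (con 1 :+ q) := p :+ q :* p) ≈-refl (M n) (qpow (2 ℕ.+ n ℕ.* 2)))

n≤double : ∀ n → n ≤ double n
n≤double n = subst (n ≤_) (i+i≡double n) (ℕ.m≤m+n n n)

-- At s = 2N the expansion has leading term `U N`, which is 1/`M N` modulo q^(N+1), and the other
-- term carries q^(2N+1). The infinite products agree with `M N` and `Pq (suc s)` to this order and
-- cancel.
rhs-coefficient : ∀ N → rhs N ≡ y (double N) N
rhs-coefficient N = ∼-trans expand (∼-trans truncate (≈⇒∼ simplify)) .coeff N ℕ.≤-refl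
  where
  open UpTo N
  s = double N
  R = Pq (suc s)
  P∞ = pochInf (qpow 1) (qpow 1)
  M∞ = pochInf (neg (qpow 2)) (qpow 2)
  sum≈U₀ : sumSeries (λ n → qpow (n ℕ.* n ℕ.+ 2 ℕ.* n) ⊛ inv (poch (qpow 4) (qpow 4) n)) ≈ U 0
  sum≈U₀ = sumSeries-cong {λ n → qpow (n ℕ.* n ℕ.+ 2 ℕ.* n) ⊛ inv (poch (qpow 4) (qpow 4) n)} {u 0}
    λ n → ⊛-cong (qpow-cong (sym (ℕ.+-identityʳ (n ℕ.* n ℕ.+ 2 ℕ.* n))))
      (≈-trans (inv-cong (⊛-const {P2 n} {M n} (poch-const 1 2 n) (poch-neg-const 1 2 n)) (poch-4 n))
        (inv-⊛ {P2 n} {M n} (poch-const 1 2 n) (poch-neg-const 1 2 n)))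
  expand : rhs ∼ (R ⊛ (y s ⊛ U N ⊕ qpow (suc s) ⊛ (z s ⊛ G 0 (suc s)))) ⊛ M∞ ⊛ inv P∞
  expand = ≈⇒∼ (*-congʳ {inv P∞} (*-congʳ {M∞} (≈-trans sum≈U₀
    (subst (λ g → U 0 ≈ R ⊛ (y s ⊛ g ⊕ qpow (suc s) ⊛ (z s ⊛ G 0 (suc s)))) (G-double 0 N) (U₀-expansion s)))))
  U-leading : U N ∼ inv (M N)
  U-leading .coeff k k≤N = trans (sumUpTo-extend (λ n → u N n k) 1 (suc k) (s≤s z≤n) higher)
    (trans (ℤ.+-identityʳ (u N 0 k)) (leading .at k))
    where
    higher : ∀ n → 1 ≤ n → u N n k ≡ 0ℤ
    -- The term `double N ℕ.* n` already bounds `k`; the strict inequality takes a unit from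
    -- `n ℕ.* n`.
    higher n@(suc n′) _ = qpow-⊛-< (n ℕ.* n ℕ.+ 2 ℕ.* n ℕ.+ double N ℕ.* n) (d N n) k (s≤s (ℕ.≤-trans k≤N (ℕ.≤-trans (n≤double N)
      (ℕ.≤-trans (ℕ.m≤m*n s n) (ℕ.m≤n+m (s ℕ.* n) (n′ ℕ.+ n′ ℕ.* n ℕ.+ 2 ℕ.* n))))))
    exponent : 0 ℕ.* 0 ℕ.+ 2 ℕ.* 0 ℕ.+ double N ℕ.* 0 ≡ 0
    exponent = ℕ.*-zeroʳ (double N)
    leading : u N 0 ≈ inv (M N)
    leading = begin
      u N 0                                ≈⟨ *-congʳ {d N 0} (≈-trans (qpow-cong exponent) qpow-zero) ⟩
      one ⊛ d N 0                          ≈⟨ ⊛-identityˡ (d N 0) ⟩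
      inv one ⊛ inv (M (N ℕ.+ 0))          ≈⟨ ⊛-cong (≈-sym (inv-unique {one} {one} refl (⊛-identityˡ one))) (≈-reflexive (cong (λ n → inv (M n)) (ℕ.+-identityʳ N))) ⟩
      one ⊛ inv (M N)                      ≈⟨ ⊛-identityˡ (inv (M N)) ⟩
      inv (M N)                            ∎
  M∞∼ : M∞ ∼ M N
  -- At q^k `pochInf` reads the product of k + 1 factors; it and `M N` both agree there with `M k`.
  M∞∼ .coeff k k≤N = trans (M-stable (ℕ.n≤1+n k)) (sym (M-stable k≤N))
  P∞∼ : P∞ ∼ R
  P∞∼ .coeff k k≤N = trans (Pq-stable (ℕ.n≤1+n k))
    (sym (Pq-stable (ℕ.≤-trans k≤N (ℕ.≤-trans (n≤double N) (ℕ.n≤1+n s)))))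
  truncate : (R ⊛ (y s ⊛ U N ⊕ qpow (suc s) ⊛ (z s ⊛ G 0 (suc s)))) ⊛ M∞ ⊛ inv P∞
    ∼ (R ⊛ (y s ⊛ inv (M N))) ⊛ M N ⊛ inv R
  truncate = ⊛-cong-∼ (⊛-cong-∼ (⊛-cong-∼ {R} (≈⇒∼ ≈-refl) (∼-trans
      (drop-qpow (suc s) (y s ⊛ U N) (z s ⊛ G 0 (suc s)) (s≤s (n≤double N))) (⊛-cong-∼ {y s} (≈⇒∼ ≈-refl) U-leading))) M∞∼)
    (inv-cong-∼ refl (poch-const 0 1 (suc s)) P∞∼)
  simplify : (R ⊛ (y s ⊛ inv (M N))) ⊛ M N ⊛ inv R ≈ y s
  simplify = begin
    (R ⊛ (y s ⊛ inv (M N))) ⊛ M N ⊛ inv R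
      ≈⟨ solve 5 (λ r y i m j → r :* (y :* i) :* m :* j := y :* ((r :* j) :* (m :* i))) ≈-refl R (y s) (inv (M N)) (M N) (inv R) ⟩
    y s ⊛ ((R ⊛ inv R) ⊛ (M N ⊛ inv (M N)))
      ≈⟨ *-congˡ {y s} (⊛-cong (⊛-inv R (poch-const 0 1 (suc s))) (⊛-inv (M N) (poch-neg-const 1 2 N))) ⟩
    y s ⊛ (one ⊛ one)  ≈⟨ *-congˡ {y s} (⊛-identityˡ one) ⟩
    y s ⊛ one          ≈⟨ ⊛-identityʳ (y s) ⟩
    y s                ∎

theorem4p2 : (N : ℕ) →
    Σ (List (Vec (List ℕ) 2)) (λ L →
    All (λ Λ → CylPart profile30 Λ × size Λ ≡ N) L ×
    Unique L ×
    ((Λ : Vec (List ℕ) 2) → CylPart profile30 Λ → size Λ ≡ N → Λ ∈ L) ×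
    (+ length L ≡ rhs N))
theorem4p2 N = curry-complete (Count-⇔ forget bound
    (subst (Count (Cyl (Below (suc N) N) N)) (sym (rhs-coefficient N)) (Enumerates-y-odd N N)))
  where
  forget : ∀ Λ → Cyl (Below (suc N) N) N Λ → CylPart profile30 Λ × size Λ ≡ N
  forget (l ∷ m ∷ []) (cyl , sz , _) = cyl , sz
  -- A pair of size `N` has at most `N` parts in all, so it lies below (N + 1 , N), the middle pair
  -- of weight 2N + 1.
  bound : ∀ Λ → CylPart profile30 Λ × size Λ ≡ N → Cyl (Below (suc N) N) N Λ
  bound (l ∷ m ∷ []) (cyl , refl) = cyl , refl ,
    ( ℕ.m≤n⇒m≤1+n (ℕ.≤-trans (ℕ.m≤m+n _ _) (size-≥-lengths cyl))
    , ℕ.≤-trans (ℕ.m≤n+m _ (length l)) (size-≥-lengths cyl))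
  curry-complete : Count (λ Λ → CylPart profile30 Λ × size Λ ≡ N) (rhs N) → _
  curry-complete (L , all , uniq , complete , len) = L , all , uniq , (λ Λ cyl sz → complete Λ (cyl , sz)) , len
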